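{- Let $G=(V,E)$ be a finite connected graph with at least one edge, and let $\mathcal{G}$ be any rooted combinatorial embedding of $G$. Then the Tutte polynomial of $G$ satisfies $$T_G(x,y)=\sum_{T \text{ spanning tree of } G} x^{\mathcal{I}(T)}\,y^{\mathcal{E}(T)},$$ where the sum is over all spanning trees $T$ of $G$ and $\mathcal{I}(T)$ (resp. $\mathcal{E}(T)$) is the number of $(\mathcal{G},T)$-active internal (resp. external) edges.
   Context: Graphs are finite and undirected; loops and multiple edges are allowed. Tutte polynomial: for a graph $G=(V,E)$, $$T_G(x,y)=\sum_{S\subseteq E}(x-1)^{c(S)-c(G)}(y-1)^{c(S)+|S|-|V|},$$ where each $S\subseteq E$ is identified with the spanning subgraph $(V,S)$, and $c(S)$, $c(G)$ denote the numbers of connected components of $(V,S)$ and of $G$. Combinatorial maps and embeddings: a combinatorial map $\mathcal{G}=(H,\sigma,\alpha)$ consists of a finite set $H$ of half-edges, a permutation $\sigma$ of $H$ and an involution $\alpha$ of $H$ without fixed points, such that the group generated by $\sigma$ and $\alpha$ acts transitively on $H$. It is rooted if one half-edge $h_0\in H$ is distinguished as the root; one then writes $\mathcal{G}=(H,\sigma,\alpha,h_0)$. The underlying graph of $\mathcal{G}$ has as vertices the cycles of $\sigma$ and as edges the cycles of $\alpha$ (so an edge is a pair $\{h,\alpha(h)\}$ of half-edges), an edge being incident to a vertex if they have at least one half-edge in common. A (rooted) combinatorial embedding of a connected graph $G$ is a (rooted) combinatorial map whose underlying graph is isomorphic to $G$; the edges of $G$ are then identified with pairs of half-edges. No planarity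 is required. Products of permutations are compositions: $\sigma\alpha(h)=\sigma(\alpha(h))$. Spanning trees: a spanning tree $T$ of $G$ is a connected acyclic spanning subgraph, identified with its edge set. An edge (or a half-edge belonging to it) is internal if the edge is in $T$, and external otherwise. The fundamental cycle of an external edge $e$ is the set of edges $f$ such that $(T\cup\{e\})\setminus\{f\}$ is a spanning tree; the fundamental cocycle of an internal edge $e$ is the set of edges $f$ such that $(T\setminus\{e\})\cup\{f\}$ is a spanning tree. (In both cases $e$ itself belongs to the set.) Motion function: given $\mathcal{G}$ and a spanning tree $T$, the motion function $t:H\to H$ is defined by $t(h)=\sigma(h)$ if $h$ is external and $t(h)=\sigma\alpha(h)$ if $h$ is internal. It is a cyclic permutation of $H$ (a single cycle containing all of $H$). $(\mathcal{G},T)$-order: for $\mathcal{G}$ with root $h_0$, the $(\mathcal{G},T)$-order on $H$ is the linear order $h_0<t(h_0)<t^2(h_0)<\cdots<t^{|H|-1}(h_0)$. The $(\mathcal{G},T)$-order on edges is the linear order defined by $\{h_1,h_2\}<\{h_1',h_2'\}$ if $\min(h_1,h_2)<\min(h_1',h_2')$. Activity: an external (resp. internal) edge is $(\mathcal{G},T)$-active (embedding-active) if it is minimal for the $(\mathcal{G},T)$-order in its fundamental cycle (resp. fundamental cocycle). -}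

module Defs where

open import Algebra.Bundles using (CommutativeRing)
import Algebra.Properties.Semiring.Exp as Exp
open import Data.Fin.Base using (Fin; _≤_)
open import Data.Fin.Permutation using (Permutation′; _⟨$⟩ʳ_)
open import Data.Fin.Properties using (_≟_; _≤?_; any?; all?; injective⇒≤)
open import Data.Fin.Subset
  using (Subset; inside; outside; _∈_; _∉_; ⊤; ⁅_⁆; _∪_; _-_; ∣_∣)
open import Data.Fin.Subset.Properties using (_∈?_)
open import Data.List.Base
  using (List; []; _∷_; _++_; map; foldr; filter; length; lookup; iterate;
         takeWhile; allFin)
open import Data.List.Membership.Propositional using () renaming (_∈_ to _∈ˡ_)
open import Data.List.Membership.Propositional.Properties
  using (∈-filter⁺; ∈-filter⁻; ∈-allFin; ∈-lookup)
import Data.List.Properties as List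
open import Data.List.Relation.Unary.All using (_∷_)
import Data.List.Relation.Unary.All as All
open import Data.List.Relation.Unary.AllPairs using (_∷_)
open import Data.List.Relation.Unary.Any using (here; there)
open import Data.List.Relation.Unary.Unique.Propositional using (Unique)
import Data.List.Relation.Unary.Unique.DecPropositional as UniqueDec
import Data.Nat.Base as ℕ
open import Data.Nat.Base using (ℕ; zero; suc; _+_; _∸_; _⊓_; z≤n; s≤s)
import Data.Nat.Properties as ℕ
open import Data.Product.Base using (∃; _×_; _,_; proj₁; proj₂)
open import Data.Product.Properties using (≡-dec)
open import Data.Sum.Base using (_⊎_; inj₁; inj₂)
import Data.Vec.Base as Vec
open import Function.Base using (_∘_)
open import Function.Bundles using (Inverse; _⇔_)
open import Function.Definitions using (Injective)
open import Level using (Level)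
open import Relation.Binary.Bundles using (Setoid)
open import Relation.Binary.Construct.Closure.Equivalence as Eq using (EqClosure)
open import Relation.Binary.Construct.Closure.ReflexiveTransitive
  using (Star; ε; _◅_; _◅◅_; gmap; reverse)
open import Relation.Binary.PropositionalEquality
  using (_≡_; _≢_; refl; sym; trans; cong; subst; setoid)
open import Relation.Nullary.Decidable
  using (Dec; yes; no; map′; ¬?; _×-dec_; _⊎-dec_; _→-dec_)
open import Relation.Nullary.Negation using (¬_; contradiction)
open import Relation.Unary using (Pred; Decidable)

private
  variable
    a c ℓ : Level
    A : Set a
    m n : ℕ

-- `ends e` is to be read as an unordered pair: it is only ever used through
-- `Joins` and `Incident`, which do not depend on the order of its components.
record Graph : Set where
  field
    #V   : ℕ
    #E   : ℕ
    ends : Fin #E → Fin #V × Fin #V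

  V E : Set
  V = Fin #V
  E = Fin #E

  Joins : E → V → V → Set
  Joins e u v = ends e ≡ (u , v) ⊎ ends e ≡ (v , u)

  Incident : E → V → Set
  Incident e v = v ≡ proj₁ (ends e) ⊎ v ≡ proj₂ (ends e)

  Adjacent : Subset #E → V → V → Set
  Adjacent S u v = ∃ λ e → e ∈ S × Joins e u v

  Linked : Subset #E → V → V → Set
  Linked S = Star (Adjacent S)

  IsConnected : Subset #E → Set
  IsConnected S = ∀ u v → Linked S u v

  -- A walk from u to w, as the list of the edges it traverses, each paired
  -- with the vertex reached by it.
  data Walk (S : Subset #E) : V → List (E × V) → V → Set where
    []  : ∀ {u} → Walk S u [] u
    _∷_ : ∀ {e u v w p} → e ∈ S × Joins e u v → Walk S v p w →
          Walk S u ((e , v) ∷ p) w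

  -- Loops (length 1) and pairs of parallel edges (length 2) are cycles.
  IsCycle : Subset #E → List (E × V) → Set
  IsCycle S p = p ≢ [] × (∃ λ u → Walk S u p u) ×
                Unique (map proj₁ p) × Unique (map proj₂ p)

  Acyclic : Subset #E → Set
  Acyclic S = ¬ ∃ (IsCycle S)

  IsSpanningTree : Subset #E → Set
  IsSpanningTree T = IsConnected T × Acyclic T

private
  unique-length : (xs : List (Fin n)) → Unique xs → length xs ℕ.≤ n
  unique-length xs xs! = injective⇒≤ (inj xs xs!)
    where
    inj : ∀ ys → Unique ys → Injective _≡_ _≡_ (lookup ys)
    inj (y ∷ ys) (y∉ ∷ ys!) {Fin.zero}  {Fin.zero}  eq = refl
    inj (y ∷ ys) (y∉ ∷ ys!) {Fin.zero}  {Fin.suc j} eq =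
      contradiction eq (All.lookup y∉ (∈-lookup j))
    inj (y ∷ ys) (y∉ ∷ ys!) {Fin.suc i} {Fin.zero}  eq =
      contradiction (sym eq) (All.lookup y∉ (∈-lookup i))
    inj (y ∷ ys) (y∉ ∷ ys!) {Fin.suc i} {Fin.suc j} eq =
      cong Fin.suc (inj ys ys! eq)

  anyList? : ∀ k {P : Pred (List (Fin m × Fin n)) ℓ} → Decidable P →
             Dec (∃ λ p → length p ℕ.≤ k × P p)
  anyList? zero P? = map′
    (λ q → [] , z≤n , q)
    (λ { ([] , _ , q) → q })
    (P? [])
  anyList? (suc k) P? = map′
    (λ { (inj₁ q) → [] , z≤n , q
       ; (inj₂ (e , v , p , l , q)) → (e , v) ∷ p , s≤s l , q })
    (λ { ([] , _ , q) → inj₁ q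
       ; ((e , v) ∷ p , s≤s l , q) → inj₂ (e , v , p , l , q) })
    (P? [] ⊎-dec
      any? λ e → any? λ v → anyList? k (λ p → P? ((e , v) ∷ p)))

module _ (G : Graph) where
  open Graph G

  private
    _≟²_ : (p q : V × V) → Dec (p ≡ q)
    _≟²_ = ≡-dec _≟_ _≟_

  joins? : ∀ e u v → Dec (Joins e u v)
  joins? e u v = (ends e ≟² (u , v)) ⊎-dec (ends e ≟² (v , u))

  private
    Adjacentˡ : List E → V → V → Set
    Adjacentˡ es u v = ∃ λ e → e ∈ˡ es × Joins e u v

    symˡ : ∀ {es u v} → Adjacentˡ es u v → Adjacentˡ es v u
    symˡ (e , e∈ , inj₁ q) = e , e∈ , inj₂ q
    symˡ (e , e∈ , inj₂ q) = e , e∈ , inj₁ q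

    weaken : ∀ {e es u v} → Star (Adjacentˡ es) u v →
             Star (Adjacentˡ (e ∷ es)) u v
    weaken = gmap (λ v → v) (λ { (f , f∈ , j) → f , there f∈ , j })

    merge : V → V → V → V
    merge s t x with x ≟ s
    ... | yes _ = t
    ... | no  _ = x

    merge-s : ∀ s t → merge s t s ≡ t
    merge-s s t with s ≟ s
    ... | yes _   = refl
    ... | no  s≢s = contradiction refl s≢s

    merge-t : ∀ s t → merge s t t ≡ t
    merge-t s t with t ≟ s
    ... | yes _ = refl
    ... | no  _ = refl

    -- A choice of representative of the component of each vertex.
    label : List E → V → V
    label []       v = v
    label (e ∷ es) v =
      merge (label es (proj₁ (ends e))) (label es (proj₂ (ends e))) (label es v)

    label-adjacent : ∀ es {u v} → Adjacentˡ es u v → label es u ≡ label es v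
    label-adjacent (e ∷ es) (_ , here refl , inj₁ refl) =
      trans (merge-s (label es _) (label es _))
            (sym (merge-t (label es _) (label es _)))
    label-adjacent (e ∷ es) (_ , here refl , inj₂ refl) =
      trans (merge-t (label es _) (label es _))
            (sym (merge-s (label es _) (label es _)))
    label-adjacent (e ∷ es) (f , there f∈ , j) =
      cong (merge _ _) (label-adjacent es (f , f∈ , j))

    label-linked : ∀ es {u v} → Star (Adjacentˡ es) u v →
                   label es u ≡ label es v
    label-linked es ε        = refl
    label-linked es (a ◅ as) = trans (label-adjacent es a) (label-linked es as)

    linked-label : ∀ es v → Star (Adjacentˡ es) v (label es v)
    linked-label []       v = ε
    linked-label (e ∷ es) v
      with label es v ≟ label es (proj₁ (ends e))
    ... | no  _ = weaken (linked-label es v)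
    ... | yes q =
      weaken (subst (Star _ v) q (linked-label es v)) ◅◅
      weaken (reverse symˡ (linked-label es (proj₁ (ends e)))) ◅◅
      (e , here refl , inj₁ refl) ◅
      weaken (linked-label es (proj₂ (ends e)))

  linked? : ∀ S u v → Dec (Linked S u v)
  linked? S u v = map′
    (λ q → gmap (λ x → x) fromˡ
             (subst (Star _ u) q (linked-label es u) ◅◅
              reverse symˡ (linked-label es v)))
    (label-linked es ∘ gmap (λ x → x) toˡ)
    (label es u ≟ label es v)
    where
    es = filter (_∈? S) (allFin #E)

    fromˡ : ∀ {x y} → Adjacentˡ es x y → Adjacent S x y
    fromˡ (e , e∈ , j) = e , proj₂ (∈-filter⁻ (_∈? S) {xs = allFin #E} e∈) , j

    toˡ : ∀ {x y} → Adjacent S x y → Adjacentˡ es x y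
    toˡ (e , e∈ , j) = e , ∈-filter⁺ (_∈? S) (∈-allFin e) e∈ , j

  isConnected? : ∀ S → Dec (IsConnected S)
  isConnected? S = all? λ u → all? λ v → linked? S u v

  walk? : ∀ S u p w → Dec (Walk S u p w)
  walk? S u [] w = map′ (λ { refl → [] }) (λ { [] → refl }) (u ≟ w)
  walk? S u ((e , v) ∷ p) w = map′
    (λ { (s , q) → s ∷ q })
    (λ { (s ∷ q) → s , q })
    (((e ∈? S) ×-dec joins? e u v) ×-dec walk? S v p w)

  isCycle? : ∀ S → Decidable (IsCycle S)
  isCycle? S p =
    ¬? (List.≡-dec (≡-dec _≟_ _≟_) p []) ×-dec
    any? (λ u → walk? S u p u) ×-dec
    UniqueDec.unique? _≟_ (map proj₁ p) ×-dec
    UniqueDec.unique? _≟_ (map proj₂ p)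

  acyclic? : ∀ S → Dec (Acyclic S)
  acyclic? S = ¬? (map′ (λ { (p , _ , c) → p , c })
                        (λ { (p , c) → p , bound p c , c })
                        (anyList? #E (isCycle? S)))
    where
    bound : ∀ p → IsCycle S p → length p ℕ.≤ #E
    bound p (_ , _ , es! , _) =
      subst (ℕ._≤ #E) (List.length-map proj₁ p) (unique-length (map proj₁ p) es!)

  isSpanningTree? : Decidable IsSpanningTree
  isSpanningTree? T = isConnected? T ×-dec acyclic? T

subsets : ∀ n → List (Subset n)
subsets zero    = Vec.[] ∷ []
subsets (suc n) =
  map (outside Vec.∷_) (subsets n) ++ map (inside Vec.∷_) (subsets n)

module _ (G : Graph) where
  open Graph G

  IsLeast : Subset #E → V → Set
  IsLeast S v = ∀ u → Linked S u v → v ≤ u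

  isLeast? : ∀ S → Decidable (IsLeast S)
  isLeast? S v = all? λ u → linked? G S u v →-dec v ≤? u

  -- Each component is counted through its least vertex.
  components : Subset #E → ℕ
  components S = length (filter (isLeast? S) (allFin #V))

  spanningTrees : List (Subset #E)
  spanningTrees = filter (isSpanningTree? G) (subsets #E)

module _ (R : CommutativeRing c ℓ) where
  open CommutativeRing R
    using (Carrier; semiring; 0#; 1#; _*_)
    renaming (_+_ to _+ᴿ_; _-_ to _-ᴿ_)
  open Exp semiring using (_^_)

  sumOver : List A → (A → Carrier) → Carrier
  sumOver xs f = foldr _+ᴿ_ 0# (map f xs)

  -- The value at (x , y); the polynomial itself is the case of the two
  -- variables in ℤ[x,y]. Both exponents are nonnegative before truncation,
  -- since c(S) ≥ c(G) and c(S) ≥ |V| - |S|.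
  tutte : Graph → Carrier → Carrier → Carrier
  tutte G x y = sumOver (subsets #E) λ S →
    (x -ᴿ 1#) ^ (components G S ∸ components G ⊤) *
    (y -ᴿ 1#) ^ ((components G S + ∣ S ∣) ∸ #V)
    where open Graph G

-- The points up to lying in the same cycle of a permutation, that is, the
-- same orbit of the group it generates.
Cycles : {A : Set a} → (A → A) → Setoid a a
Cycles f = Eq.setoid (λ h h′ → f h ≡ h′)

record RootedMap : Set where
  field
    #H           : ℕ
    σ            : Permutation′ #H
    α            : Fin #H → Fin #H
    α-involutive : ∀ h → α (α h) ≡ h
    α-fixedfree  : ∀ h → α h ≢ h
    transitive   : ∀ h h′ →
      EqClosure (λ g g′ → σ ⟨$⟩ʳ g ≡ g′ ⊎ α g ≡ g′) h h′
    root         : Fin #H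

  H : Set
  H = Fin #H

  Vertices Edges : Setoid _ _
  Vertices = Cycles (σ ⟨$⟩ʳ_)
  Edges    = Cycles α

  -- Edges and vertices are given by representative half-edges.
  IncidentCycles : H → H → Set
  IncidentCycles e v =
    ∃ λ h → Setoid._≈_ Edges e h × Setoid._≈_ Vertices v h

-- A rooted map together with an isomorphism from its underlying graph to G.
record RootedEmbedding (G : Graph) : Set where
  open Graph G
  field
    rootedMap : RootedMap
  open RootedMap rootedMap public
  field
    vertexIso : Inverse Vertices (setoid V)
    edgeIso   : Inverse Edges    (setoid E)
    incidence : ∀ e v → IncidentCycles e v ⇔
                        Incident (Inverse.to edgeIso e) (Inverse.to vertexIso v)

  edgeOf : H → E
  edgeOf = Inverse.to edgeIso

  halfOf : E → H
  halfOf = Inverse.from edgeIso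

module _ {G : Graph} (𝒢 : RootedEmbedding G) (T : Subset (Graph.#E G)) where
  open Graph G
  open RootedEmbedding 𝒢

  motion : H → H
  motion h with edgeOf h ∈? T
  ... | yes _ = σ ⟨$⟩ʳ α h
  ... | no  _ = σ ⟨$⟩ʳ h

  -- The number of half-edges before h in root, t(root), t²(root), …; the
  -- order on half-edges is the comparison of ranks.
  rank : H → ℕ
  rank h = length (takeWhile (λ h′ → ¬? (h′ ≟ h)) (iterate motion root #H))

  edgeRank : E → ℕ
  edgeRank e = rank (halfOf e) ⊓ rank (α (halfOf e))

  FundamentalCycle : E → E → Set
  FundamentalCycle e f = IsSpanningTree ((T ∪ ⁅ e ⁆) - f)

  FundamentalCocycle : E → E → Set
  FundamentalCocycle e f = IsSpanningTree ((T - e) ∪ ⁅ f ⁆)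

  InternallyActive : E → Set
  InternallyActive e =
    e ∈ T × (∀ f → FundamentalCocycle e f → edgeRank e ℕ.≤ edgeRank f)

  ExternallyActive : E → Set
  ExternallyActive e =
    e ∉ T × (∀ f → FundamentalCycle e f → edgeRank e ℕ.≤ edgeRank f)

  internallyActive? : Decidable InternallyActive
  internallyActive? e = (e ∈? T) ×-dec
    all? λ f → isSpanningTree? G _ →-dec edgeRank e ℕ.≤? edgeRank f

  externallyActive? : Decidable ExternallyActive
  externallyActive? e = ¬? (e ∈? T) ×-dec
    all? λ f → isSpanningTree? G _ →-dec edgeRank e ℕ.≤? edgeRank f

  𝓘 : ℕ
  𝓘 = length (filter internallyActive? (allFin #E))

  𝓔 : ℕ
  𝓔 = length (filter externallyActive? (allFin #E))

{-# OPTIONS --safe #-}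
-- Read the tour of a spanning tree T backwards from the root. Which edge comes
-- next depends only on the status of the edges already met, so deciding at each
-- new edge whether it lies in T gives a deletion–contraction tree for G: internal
-- edges are contracted, external ones deleted. The half-edges of an internal and
-- of an external edge lying in the fundamental cycle of the latter alternate along
-- the tour, so these two edges compare in the same way by their first and by their
-- last half-edges. Hence an edge is active exactly when it has become a loop or an
-- isthmus by the time it is met, and the two sides of the identity obey the same
-- deletion–contraction recurrence.

module Submission where

open import Defs
open import Algebra.Bundles using (CommutativeRing)
import Algebra.Properties.CommutativeSemigroup
open import Algebra.Properties.Semiring.Exp using ()
open import Data.Bool.Base using (if_then_else_)
open import Data.Bool.Properties using (∨-zeroʳ; ∨-identityʳ)
open import Data.Fin.Base as Fin using (Fin; zero; suc; toℕ; fromℕ<)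
open import Data.Fin.Induction using () renaming (<-wellFounded to Fin-<-wellFounded)
open import Data.Fin.Permutation using (_⟨$⟩ʳ_; _⟨$⟩ˡ_; inverseʳ)
import Data.Fin.Properties as Fin
open import Data.Fin.Properties
  using (_≟_; any?; pigeonhole; injective⇒≤; toℕ<n; toℕ-fromℕ<)
open import Data.Fin.Subset
  using (Subset; inside; outside; _∈_; _∉_; _⊆_; ⊤; ⁅_⁆; _∪_; _-_; ∣_∣)
  renaming (⊥ to ∅)
open import Data.Fin.Subset.Properties
  using (_∈?_; x∈p∪q⁺; x∈p∪q⁻; x∈⁅x⁆; x∈⁅y⁆⇒x≡y; x∈p∧x≢y⇒x∈p-y; p─q⊆p; ∈⊤; ∉⊥;
         out⊆; s⊆s; ⊆-antisym; ⊆-refl; ⊆-min; ⊆-max; x∈p⇒∣p-x∣<∣p∣; ∪-identityʳ;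
         Empty-unique; nonempty?; ∣⊥∣≡0)
open import Data.List.Base
  using (List; []; _∷_; _++_; map; foldr; filter; length; takeWhile; iterate; allFin)
import Data.List.Membership.DecPropositional as DecMembership
open import Data.List.Membership.Propositional using () renaming (_∈_ to _∈ˡ_)
open import Data.List.Membership.Propositional.Properties using (∈-allFin)
import Data.List.Properties as List
import Data.List.Relation.Binary.Permutation.Propositional as ↭
open ↭ using (_↭_; ↭-refl; ↭-reflexive; ↭-prep; ↭-swap; ↭-trans)
open import Data.List.Relation.Binary.Permutation.Propositional.Properties using (↭-length)
open import Data.List.Relation.Unary.All as All using (All; []; _∷_)
open import Data.List.Relation.Unary.All.Properties using (¬Any⇒All¬)
open import Data.List.Relation.Unary.AllPairs using ([]; _∷_)
open import Data.List.Relation.Unary.Any using (here; there)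
open import Data.List.Relation.Unary.Unique.Propositional using (Unique)
open import Data.List.Relation.Unary.Unique.Propositional.Properties using (allFin⁺)
open import Data.Nat.Base as ℕ
  using (ℕ; zero; suc; _∸_; _≤_; _<_; _⊔_; _⊓_; z≤n; s≤s; NonZero)
open import Data.Nat.DivMod using (_%_; _/_; m%n<n; m≡m%n+[m/n]*n)
open import Data.Nat.GeneralisedArithmetic using (fold; fold-+)
open import Data.Nat.Induction using (<-wellFounded)
import Data.Nat.Properties as ℕ
open import Data.Product.Base using (∃; _×_; _,_; proj₁; proj₂)
open import Data.Sum.Base as Sum using (_⊎_; inj₁; inj₂; [_,_]′)
open import Data.Vec.Base using ([]; _∷_; _[_]≔_; here; there)
open import Function.Base using (_∘_; id)
open import Function.Bundles using (Inverse; Equivalence; Bijection)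
open import Function.Definitions using (Injective)
open import Function.Properties.Inverse using (Inverse⇒Bijection)
open import Induction.WellFounded using (Acc; acc)
open import Level using (Level)
open import Relation.Binary.Construct.Closure.Equivalence using (EqClosure)
open import Relation.Binary.Construct.Closure.ReflexiveTransitive
  using (ε; _◅_; _◅◅_; gmap; reverse)
open import Relation.Binary.Construct.Closure.Symmetric using (fwd; bwd)
open import Relation.Binary.Definitions using (tri<; tri≈; tri>)
open import Relation.Binary.PropositionalEquality
  using (_≡_; _≢_; refl; sym; trans; cong; cong₂; subst; subst₂)
open import Relation.Nullary.Decidable
  using (Dec; yes; no; does; ¬?; _×-dec_; decidable-stable)
open import Relation.Nullary.Negation using (¬_; contradiction)
open import Relation.Unary using (Pred; Decidable)

-- The order on the edges varies with the tree, so no order fixed in advance can drive the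
-- deletion-contraction induction. The tour of every tree does return to the root after `#H` steps,
-- which gives all trees a common starting point.
--
-- The direction of reading matters. Backwards, an edge is met at its last half-edge, when the edges
-- already decided are those whose last half-edge comes later. If `e` is minimal in its fundamental
-- cycle, the rest of that cycle has by then been contracted, so `e` has become a loop; dually, the
-- rest of a cocycle has been deleted. Read forwards, those edges would all still be undecided, and
-- activity would leave no trace in the minor.
--
-- No minor is ever constructed. Contracting `A` and deleting the complement of `C` is represented
-- by the interval of edge sets `S` with `A ⊆ S ⊆ C`, so that components, tours and activities
-- always refer to the original graph and embedding, and deletion-contraction becomes the splitting
-- of an interval.

-- Inserting and deleting one element of a finite subset.

module _ {n : ℕ} where

  ∈-insert : {S : Subset n} {e f : Fin n} → f ∈ S → f ∈ S ∪ ⁅ e ⁆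
  ∈-insert = x∈p∪q⁺ ∘ inj₁

  ∈-inserted : (S : Subset n) {e : Fin n} → e ∈ S ∪ ⁅ e ⁆
  ∈-inserted S {e} = x∈p∪q⁺ {p = S} (inj₂ (x∈⁅x⁆ e))

  ∈-insert⁻ : {S : Subset n} {e f : Fin n} → f ∈ S ∪ ⁅ e ⁆ → f ∈ S ⊎ f ≡ e
  ∈-insert⁻ {S} {e} f∈ = Sum.map₂ (x∈⁅y⁆⇒x≡y e) (x∈p∪q⁻ S ⁅ e ⁆ f∈)

  ∈-delete⁺ : {S : Subset n} {e f : Fin n} → f ∈ S → f ≢ e → f ∈ S - e
  ∈-delete⁺ = x∈p∧x≢y⇒x∈p-y

  ∈-delete⁻ : {S : Subset n} {e f : Fin n} → f ∈ S - e → f ∈ S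
  ∈-delete⁻ {S} {e} = p─q⊆p S ⁅ e ⁆

∉-deleted : ∀ {n} (S : Subset n) e → e ∉ S - e
∉-deleted (_ ∷ S) zero    ()
∉-deleted (_ ∷ S) (suc e) (there e∈) = ∉-deleted S e e∈

module _ {n : ℕ} where

  ∈-delete⇒≢ : {S : Subset n} {e f : Fin n} → f ∈ S - e → f ≢ e
  ∈-delete⇒≢ {S} {e} f∈ refl = ∉-deleted S e f∈

  ⊆-delete : {S S′ : Subset n} {e : Fin n} → S ⊆ S′ → e ∉ S → S ⊆ S′ - e
  ⊆-delete S⊆ e∉ f∈ = ∈-delete⁺ (S⊆ f∈) λ { refl → e∉ f∈ }

  insert-⊆ : {S S′ : Subset n} {e : Fin n} → S ⊆ S′ → e ∈ S′ → S ∪ ⁅ e ⁆ ⊆ S′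
  insert-⊆ S⊆ e∈ f∈ with ∈-insert⁻ f∈
  ... | inj₁ f∈S  = S⊆ f∈S
  ... | inj₂ refl = e∈

  ⊆-insert-delete : (S : Subset n) (e : Fin n) → S ⊆ (S - e) ∪ ⁅ e ⁆
  ⊆-insert-delete S e {f} f∈ with f ≟ e
  ... | yes refl = ∈-inserted (S - e)
  ... | no f≢e   = ∈-insert (∈-delete⁺ f∈ f≢e)

  insert-delete-⊆ : (S : Subset n) (e : Fin n) → (S ∪ ⁅ e ⁆) - e ⊆ S
  insert-delete-⊆ S e f∈ with ∈-insert⁻ (∈-delete⁻ f∈)
  ... | inj₁ f∈S = f∈S
  ... | inj₂ f≡e = contradiction f≡e (∈-delete⇒≢ f∈)

  delete-mono : {S S′ : Subset n} {e : Fin n} → S ⊆ S′ → S - e ⊆ S′ - e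
  delete-mono S⊆ f∈ = ∈-delete⁺ (S⊆ (∈-delete⁻ f∈)) (∈-delete⇒≢ f∈)

  insert-mono : {S S′ : Subset n} {e : Fin n} → S ⊆ S′ → S ∪ ⁅ e ⁆ ⊆ S′ ∪ ⁅ e ⁆
  insert-mono {S′ = S′} S⊆ = insert-⊆ (∈-insert ∘ S⊆) (∈-inserted S′)

  insert-delete-comm : (S : Subset n) {e f : Fin n} → e ≢ f →
                       (S ∪ ⁅ e ⁆) - f ≡ (S - f) ∪ ⁅ e ⁆
  insert-delete-comm S {e} {f} e≢f = ⊆-antisym to
    (insert-⊆ (delete-mono ∈-insert) (∈-delete⁺ (∈-inserted S) e≢f))
    where
    to : (S ∪ ⁅ e ⁆) - f ⊆ (S - f) ∪ ⁅ e ⁆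
    to g∈ with ∈-insert⁻ (∈-delete⁻ g∈)
    ... | inj₁ g∈S  = ∈-insert (∈-delete⁺ g∈S (∈-delete⇒≢ g∈))
    ... | inj₂ refl = ∈-inserted (S - f)

  delete-insert : {S : Subset n} {e : Fin n} → e ∈ S → (S - e) ∪ ⁅ e ⁆ ≡ S
  delete-insert {S} {e} e∈ =
    ⊆-antisym (insert-⊆ ∈-delete⁻ e∈) (⊆-insert-delete S e)

delete-zero : ∀ {n} s (S : Subset n) → (s ∷ S) - zero ≡ outside ∷ S
delete-zero s S = ⊆-antisym to λ { (there f∈) →
  ∈-delete⁺ {S = s ∷ S} {zero} (there f∈) λ () }
  where
  to : (s ∷ S) - zero ⊆ outside ∷ S
  to {zero}  f∈ = contradiction refl (∈-delete⇒≢ {S = s ∷ S} {zero} f∈)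
  to {suc f} f∈ with ∈-delete⁻ {S = s ∷ S} {zero} f∈
  ... | there f∈S = there f∈S

delete-suc : ∀ {n} s (S : Subset n) e → (s ∷ S) - suc e ≡ s ∷ (S - e)
delete-suc s S e = ⊆-antisym to from
  where
  to : (s ∷ S) - suc e ⊆ s ∷ (S - e)
  to {zero}  f∈ with ∈-delete⁻ {S = s ∷ S} {suc e} f∈
  ... | here = here
  to {suc f} f∈ with ∈-delete⁻ {S = s ∷ S} {suc e} f∈
  ... | there f∈S = there (∈-delete⁺ f∈S (∈-delete⇒≢ {S = s ∷ S} {suc e} f∈ ∘ cong suc))

  from : s ∷ (S - e) ⊆ (s ∷ S) - suc e
  from here       = ∈-delete⁺ {S = s ∷ S} {suc e} here λ ()
  from (there f∈) = ∈-delete⁺ {S = s ∷ S} {suc e} (there (∈-delete⁻ f∈))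
    λ { refl → ∈-delete⇒≢ f∈ refl }

-- Interval sums recurse over vectors, where `[ e ]≔` reduces entry by entry; this identity and the
-- next carry the results over to the set operations used for graphs.
≔-delete : ∀ {n} (S : Subset n) e → S [ e ]≔ outside ≡ S - e
≔-delete (s ∷ S) zero    = sym (delete-zero s S)
≔-delete (s ∷ S) (suc e) = trans (cong (s ∷_) (≔-delete S e)) (sym (delete-suc s S e))

≔-insert : ∀ {n} (S : Subset n) e → S [ e ]≔ inside ≡ S ∪ ⁅ e ⁆
≔-insert (s ∷ S) zero    = cong₂ _∷_ (sym (∨-zeroʳ s)) (sym (∪-identityʳ S))
≔-insert (s ∷ S) (suc e) = cong₂ _∷_ (sym (∨-identityʳ s)) (≔-insert S e)

-- Spanned edges, forests and tree exchange.

module GraphLemmas (G : Graph) where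
  open Graph G

  Adjacent-sym : ∀ {S u v} → Adjacent S u v → Adjacent S v u
  Adjacent-sym (e , e∈ , inj₁ p) = e , e∈ , inj₂ p
  Adjacent-sym (e , e∈ , inj₂ p) = e , e∈ , inj₁ p

  Linked-sym : ∀ {S u v} → Linked S u v → Linked S v u
  Linked-sym = reverse Adjacent-sym

  Linked-mono : ∀ {S S′ u v} → S ⊆ S′ → Linked S u v → Linked S′ u v
  Linked-mono S⊆ = gmap id (λ { (e , e∈ , j) → e , S⊆ e∈ , j })

  end₁ end₂ : E → V
  end₁ e = proj₁ (ends e)
  end₂ e = proj₂ (ends e)

  -- In matroid terms, `e` lies in the closure of `S`. For an undecided edge, `Spanned A e` says
  -- that `e` is a loop once `A` is contracted, and `¬ Spanned (C - e) e` that it is an isthmus of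
  -- `C`.
  Spanned : Subset #E → E → Set
  Spanned S e = Linked S (end₁ e) (end₂ e)

  spanned? : ∀ S e → Dec (Spanned S e)
  spanned? S e = linked? G S (end₁ e) (end₂ e)

  -- Every edge of `S` is an isthmus. This is equivalent to `Acyclic S`, but lends itself to closure
  -- arguments without any handling of walks.
  Forest : Subset #E → Set
  Forest S = ∀ {e} → e ∈ S → ¬ Spanned (S - e) e

  Joins⇒Spanned : ∀ {S e u v} → Joins e u v → Linked S u v → Spanned S e
  Joins⇒Spanned (inj₁ refl) l = l
  Joins⇒Spanned (inj₂ refl) l = Linked-sym l

  Spanned⇒Linked : ∀ {S e u v} → Joins e u v → Spanned S e → Linked S u v
  Spanned⇒Linked (inj₁ refl) l = l
  Spanned⇒Linked (inj₂ refl) l = Linked-sym l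

  ∈⇒Spanned : ∀ {S e} → e ∈ S → Spanned S e
  ∈⇒Spanned e∈ = (_ , e∈ , inj₁ refl) ◅ ε

  -- A path using the inserted edge can be cut at its first and last use.
  Linked-insert⁻ : ∀ {S e x y} → Linked (S ∪ ⁅ e ⁆) x y →
    Linked S x y ⊎
    (Linked S x (end₁ e) × Linked S (end₂ e) y) ⊎
    (Linked S x (end₂ e) × Linked S (end₁ e) y)
  Linked-insert⁻ ε = inj₁ ε
  Linked-insert⁻ ((f , f∈ , j) ◅ l) with ∈-insert⁻ f∈
  ... | inj₁ f∈S = Sum.map ((f , f∈S , j) ◅_)
    (Sum.map (λ (p , q) → (f , f∈S , j) ◅ p , q)
             (λ (p , q) → (f , f∈S , j) ◅ p , q)) (Linked-insert⁻ l)
  ... | inj₂ refl with j | Linked-insert⁻ l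
  ...   | inj₁ refl | inj₁ q              = inj₂ (inj₁ (ε , q))
  ...   | inj₁ refl | inj₂ (inj₁ (_ , q)) = inj₂ (inj₁ (ε , q))
  ...   | inj₁ refl | inj₂ (inj₂ (_ , q)) = inj₁ q
  ...   | inj₂ refl | inj₁ q              = inj₂ (inj₂ (ε , q))
  ...   | inj₂ refl | inj₂ (inj₁ (_ , q)) = inj₁ q
  ...   | inj₂ refl | inj₂ (inj₂ (_ , q)) = inj₂ (inj₂ (ε , q))

  Linked-insert-Spanned : ∀ {S e x y} → Spanned S e →
                          Linked (S ∪ ⁅ e ⁆) x y → Linked S x y
  Linked-insert-Spanned s l with Linked-insert⁻ l
  ... | inj₁ p              = p
  ... | inj₂ (inj₁ (p , q)) = p ◅◅ s ◅◅ q
  ... | inj₂ (inj₂ (p , q)) = p ◅◅ Linked-sym s ◅◅ q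

  -- The exchange property of matroid closure: a path joining the ends of `f` must pass through `e`,
  -- and its two remaining pieces together with `f` join the ends of `e`.
  Spanned-exchange : ∀ {S e f} → Spanned (S ∪ ⁅ e ⁆) f → ¬ Spanned S f →
                     Spanned (S ∪ ⁅ f ⁆) e
  Spanned-exchange {S} {e} {f} s ¬s with Linked-insert⁻ s
  ... | inj₁ p              = contradiction p ¬s
  ... | inj₂ (inj₁ (p , q)) =
    Linked-mono ∈-insert (Linked-sym p) ◅◅ ∈⇒Spanned (∈-inserted S) ◅◅
    Linked-mono ∈-insert (Linked-sym q)
  ... | inj₂ (inj₂ (p , q)) =
    Linked-mono ∈-insert q ◅◅ Linked-sym (∈⇒Spanned (∈-inserted S)) ◅◅
    Linked-mono ∈-insert p

  Forest-mono : ∀ {S S′} → S ⊆ S′ → Forest S′ → Forest S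
  Forest-mono S⊆ F e∈ s = F (S⊆ e∈) (Linked-mono (delete-mono S⊆) s)

  -- If an old edge `f` became spanned by the others, exchange would make `e` spanned by
  -- `(S - f) ∪ ⁅ f ⁆`, hence by `S`.
  Forest-insert : ∀ {S e} → Forest S → ¬ Spanned S e → Forest (S ∪ ⁅ e ⁆)
  Forest-insert {S} {e} F ¬s {f} f∈ s with e ≟ f
  ... | yes refl = ¬s (Linked-mono (insert-delete-⊆ S e) s)
  ... | no e≢f with ∈-insert⁻ f∈
  ...   | inj₂ refl = e≢f refl
  ...   | inj₁ f∈S  = ¬s (Linked-mono (insert-⊆ ∈-delete⁻ f∈S)
    (Spanned-exchange
      (subst (λ X → Spanned X f) (insert-delete-comm S e≢f) s) (F f∈S)))

  IsConnected-mono : ∀ {S S′} → S ⊆ S′ → IsConnected S → IsConnected S′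
  IsConnected-mono S⊆ c u v = Linked-mono S⊆ (c u v)

  IsConnected-delete : ∀ {S e} → IsConnected S → Spanned (S - e) e →
                       IsConnected (S - e)
  IsConnected-delete {S} {e} c s u v =
    Linked-insert-Spanned s (Linked-mono (⊆-insert-delete S e) (c u v))

  -- The edges of a cycle being distinct, its tail avoids its first edge and joins the ends of that
  -- edge.
  forest⇒acyclic : ∀ {S} → Forest S → Acyclic S
  forest⇒acyclic F ([] , ne , _) = ne refl
  forest⇒acyclic {S} F ((e , v) ∷ p , _ , (u , (e∈ , j) ∷ w) , e∉ ∷ _ , _) =
    F e∈ (Joins⇒Spanned j (Linked-sym (linked w e∉)))
    where
    linked : ∀ {x p y} → Walk S x p y → All (e ≢_) (map proj₁ p) →
             Linked (S - e) x y
    linked []             []         = ε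
    linked ((f∈ , i) ∷ w) (e≢f ∷ e≢) =
      (_ , ∈-delete⁺ f∈ (e≢f ∘ sym) , i) ◅ linked w e≢

  vertices edges : List (E × V) → List _
  vertices = map proj₂
  edges    = map proj₁

  Path : Subset #E → V → V → Set
  Path S u w = ∃ λ p → Walk S u p w × Unique (u ∷ vertices p)

  cut : ∀ {S v w p u} → Walk S v p w → Unique (v ∷ vertices p) →
        u ∈ˡ v ∷ vertices p → Path S u w
  cut w       u!       (here refl) = _ , w , u!
  cut (_ ∷ w) (_ ∷ u!) (there u∈)  = cut w u! u∈

  -- Loop erasure: when the new starting vertex already occurs on the path, everything before that
  -- occurrence is dropped.
  linked⇒path : ∀ {S u w} → Linked S u w → Path S u w
  linked⇒path ε = [] , [] , [] ∷ []
  linked⇒path {u = u} ((e , e∈ , j) ◅ l) with linked⇒path l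
  ... | p , w , u! with DecMembership._∈?_ _≟_ u (_ ∷ vertices p)
  ...   | yes u∈ = cut w u! u∈
  ...   | no  u∉ = _ , (e∈ , j) ∷ w , ¬Any⇒All¬ _ u∉ ∷ u!

  edge∈walk : ∀ {S v p w e} → Walk S v p w → e ∈ˡ map proj₁ p →
              e ∈ S × end₁ e ∈ˡ v ∷ vertices p × end₂ e ∈ˡ v ∷ vertices p
  edge∈walk ((e∈ , inj₁ refl) ∷ w) (here refl) = e∈ , here refl , there (here refl)
  edge∈walk ((e∈ , inj₂ refl) ∷ w) (here refl) = e∈ , there (here refl) , here refl
  edge∈walk (_ ∷ w) (there e∈) with edge∈walk w e∈
  ... | e∈S , p , q = e∈S , there p , there q

  -- If the first edge were used again, its end `u` would be visited again.
  path⇒uniqueEdges : ∀ {S u p w} → Walk S u p w → Unique (u ∷ vertices p) →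
                     Unique (edges p)
  path⇒uniqueEdges []       _ = []
  path⇒uniqueEdges {S} {u} {(e , v) ∷ p} ((e∈ , j) ∷ w) (u∉ ∷ u!) =
    ¬Any⇒All¬ _ (λ e∈p → All.lookup u∉ (u∈ j (edge∈walk w e∈p)) refl) ∷
    path⇒uniqueEdges w u!
    where
    u∈ : Joins e u v → e ∈ S × end₁ e ∈ˡ v ∷ vertices p × end₂ e ∈ˡ v ∷ vertices p →
         u ∈ˡ v ∷ vertices p
    u∈ (inj₁ refl) (_ , q , _) = q
    u∈ (inj₂ refl) (_ , _ , q) = q

  Walk-mono : ∀ {S S′ u p w} → S ⊆ S′ → Walk S u p w → Walk S′ u p w
  Walk-mono S⊆ []             = []
  Walk-mono S⊆ ((e∈ , j) ∷ w) = (S⊆ e∈ , j) ∷ Walk-mono S⊆ w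

  -- A path in `S - e` from `end₂ e` to `end₁ e` is closed up by `e`; if `e` is a loop the path is
  -- empty.
  acyclic⇒forest : ∀ {S} → Acyclic S → Forest S
  acyclic⇒forest {S} A {e} e∈ s with linked⇒path (Linked-sym s)
  ... | p , w , u! = A
    ( (e , end₂ e) ∷ p , (λ ())
    , (end₁ e , (e∈ , inj₁ refl) ∷ Walk-mono ∈-delete⁻ w)
    , ¬Any⇒All¬ _ (∉-deleted S e ∘ proj₁ ∘ edge∈walk w) ∷ path⇒uniqueEdges w u!
    , u!)

  tree⇒forest : ∀ {T} → IsSpanningTree T → Forest T
  tree⇒forest = acyclic⇒forest ∘ proj₂

  -- By the exchange property the new set spans `i`, so it stays connected; it stays a forest
  -- because `x` is not spanned by `T - i`.
  exchange : ∀ {T i x} → IsSpanningTree T → i ∈ T → ¬ Spanned (T - i) x →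
             IsSpanningTree ((T - i) ∪ ⁅ x ⁆)
  exchange {T} {i} {x} (c , a) i∈ ¬s =
    (λ u v → Linked-insert-Spanned
      (Spanned-exchange (Linked-mono (⊆-insert-delete T i) (c _ _)) ¬s)
      (Linked-mono (insert-⊆ insert⊆ (∈-inserted _)) (c′ u v))) ,
    forest⇒acyclic (Forest-insert (Forest-mono ∈-delete⁻ (acyclic⇒forest a)) ¬s)
    where
    c′ : IsConnected ((T - i) ∪ ⁅ i ⁆)
    c′ = IsConnected-mono (⊆-insert-delete T i) c
    insert⊆ : T - i ⊆ ((T - i) ∪ ⁅ x ⁆) ∪ ⁅ i ⁆
    insert⊆ = ∈-insert ∘ ∈-insert

  -- Should either conclusion fail, `e` would be spanned by the other edges of the new tree.
  fundamentalCycle⁻ : ∀ {T e f} → IsSpanningTree T → e ∉ T →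
    IsSpanningTree ((T ∪ ⁅ e ⁆) - f) → f ≢ e → f ∈ T × ¬ Spanned (T - f) e
  fundamentalCycle⁻ {T} {e} {f} (c , _) e∉ t′ f≢e with f ∈? T
  ... | yes f∈ = f∈ , λ s → tree⇒forest t′
    (∈-delete⁺ (∈-inserted T) (f≢e ∘ sym))
    (Linked-mono (⊆-delete (delete-mono ∈-insert) (e∉ ∘ ∈-delete⁻)) s)
  ... | no f∉ = contradiction
    (Linked-mono (⊆-delete (⊆-delete ∈-insert f∉) e∉) (c _ _))
    (tree⇒forest t′ (∈-delete⁺ (∈-inserted T) (f≢e ∘ sym)))

  -- If `T - e` spanned `f`, adding `f` would connect nothing new, and `T - e` would already span
  -- `e`. An edge of `T` other than `e` is trivially spanned by `T - e`.
  fundamentalCocycle⁻ : ∀ {T e f} → IsSpanningTree T → e ∈ T →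
    IsSpanningTree ((T - e) ∪ ⁅ f ⁆) → f ≢ e → f ∉ T × ¬ Spanned (T - e) f
  fundamentalCocycle⁻ {T} {e} {f} t e∈ (c′ , _) f≢e =
    (λ f∈ → ¬s (∈⇒Spanned (∈-delete⁺ f∈ f≢e))) , ¬s
    where
    ¬s : ¬ Spanned (T - e) f
    ¬s s = tree⇒forest t e∈ (Linked-insert-Spanned s (c′ _ _))

  -- Delete the edges of T ∖ A one at a time until e is no longer spanned.
  critical-edge : ∀ {T A e} → A ⊆ T → Spanned T e → ¬ Spanned A e →
    ∃ λ D → D ⊆ T × ∃ λ f → f ∈ D × f ∉ A ×
      ¬ Spanned (D - f) e × Spanned ((D - f) ∪ ⁅ e ⁆) f
  critical-edge {T} {A} {e} A⊆T = go T ⊆-refl (<-wellFounded _) A⊆T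
    where
    go : ∀ D → D ⊆ T → Acc ℕ._<_ ∣ D ∣ → A ⊆ D → Spanned D e → ¬ Spanned A e →
         ∃ λ D → D ⊆ T × ∃ λ f → f ∈ D × f ∉ A ×
           ¬ Spanned (D - f) e × Spanned ((D - f) ∪ ⁅ e ⁆) f
    go D D⊆ (acc rec) A⊆ s ¬s with any? (λ f → (f ∈? D) ×-dec ¬? (f ∈? A))
    ... | no none = contradiction
      (Linked-mono (λ {f} f∈ → decidable-stable (f ∈? A) λ f∉ → none (f , f∈ , f∉)) s) ¬s
    ... | yes (f , f∈ , f∉) with spanned? (D - f) e
    ...   | yes s′ = go (D - f) (D⊆ ∘ ∈-delete⁻) (rec (x∈p⇒∣p-x∣<∣p∣ f∈))
                        (⊆-delete A⊆ f∉) s′ ¬s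
    ...   | no ¬s′ = D , D⊆ , f , f∈ , f∉ , ¬s′ ,
      Spanned-exchange (Linked-mono (⊆-insert-delete D f) s) ¬s′

  -- Finds an edge of the fundamental cycle of `e` outside `A`. The critical edge `f` is spanned by
  -- `e` and part of `T - f`; if `T - f` spanned `e`, it would span `f` as well, against `Forest T`.
  separating-edge : ∀ {T A e} → Forest T → A ⊆ T → Spanned T e → ¬ Spanned A e →
                    ∃ λ f → f ∈ T × f ∉ A × ¬ Spanned (T - f) e
  separating-edge F A⊆T s ¬s with critical-edge A⊆T s ¬s
  ... | D , D⊆ , f , f∈ , f∉ , _ , s′ = f , D⊆ f∈ , f∉ , λ sT →
    F (D⊆ f∈) (Linked-insert-Spanned sT
      (Linked-mono (insert-mono (delete-mono D⊆)) s′))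

  -- A path all of whose edges are spanned by `S` never leaves its component of `S`.
  reconnecting-edge : ∀ {S C x y} → Linked C x y → ¬ Linked S x y →
                      ∃ λ f → f ∈ C × ¬ Spanned S f
  reconnecting-edge ε ¬l = contradiction ε ¬l
  reconnecting-edge {S} ((f , f∈ , j) ◅ l) ¬l with spanned? S f
  ... | no ¬s = f , f∈ , ¬s
  ... | yes s = reconnecting-edge l λ l′ → ¬l (Spanned⇒Linked j s ◅◅ l′)

  -- Edges outside `A` that are not isthmuses are deleted as long as there are any.
  tree-between : ∀ {A C} → Forest A → IsConnected C → A ⊆ C →
                 ∃ λ T → IsSpanningTree T × A ⊆ T × T ⊆ C
  tree-between {A} {C} F c A⊆C = go C (<-wellFounded _) c A⊆C ⊆-refl
    where
    go : ∀ D → Acc ℕ._<_ ∣ D ∣ → IsConnected D → A ⊆ D → D ⊆ C →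
         ∃ λ T → IsSpanningTree T × A ⊆ T × T ⊆ C
    go D (acc rec) cD A⊆ D⊆
      with any? (λ f → (f ∈? D) ×-dec ¬? (f ∈? A) ×-dec spanned? (D - f) f)
    ... | yes (f , f∈ , f∉ , s) =
      go (D - f) (rec (x∈p⇒∣p-x∣<∣p∣ f∈)) (IsConnected-delete cD s)
         (⊆-delete A⊆ f∉) (D⊆ ∘ ∈-delete⁻)
    ... | no none = D , (cD , forest⇒acyclic forest) , A⊆ , D⊆
      where
      forest : Forest D
      forest {f} f∈ s with f ∈? A
      ... | no f∉ = none (f , f∈ , f∉ , s)
      -- A spanned edge `f` of `A` would lie on a cycle of `D`. As `A` is a forest, this cycle
      -- leaves `A`, at an edge `g` that could still have been deleted.
      ... | yes f∈A with critical-edge (delete-mono A⊆) s (F f∈A)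
      ...   | X , X⊆ , g , g∈ , g∉ , _ , s′ = none
        ( g , ∈-delete⁻ (X⊆ g∈)
        , (λ g∈A → g∉ (∈-delete⁺ g∈A g≢f))
        , Linked-mono (insert-⊆ (delete-mono (∈-delete⁻ ∘ X⊆))
                                (∈-delete⁺ f∈ (g≢f ∘ sym))) s′)
        where
        g≢f : g ≢ f
        g≢f = ∈-delete⇒≢ (X⊆ g∈)

-- Cardinalities and filtered lists.

∣insert∣ : ∀ {n} (S : Subset n) {e} → e ∉ S → ∣ S ∪ ⁅ e ⁆ ∣ ≡ suc ∣ S ∣
∣insert∣ (inside  ∷ S) {zero}  e∉ = contradiction here e∉
∣insert∣ (outside ∷ S) {zero}  e∉ = cong (suc ∘ ∣_∣) (∪-identityʳ S)
∣insert∣ (inside  ∷ S) {suc e} e∉ = cong suc (∣insert∣ S (e∉ ∘ there))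
∣insert∣ (outside ∷ S) {suc e} e∉ = ∣insert∣ S (e∉ ∘ there)

module _ {a p q} {A : Set a} {P : Pred A p} {Q : Pred A q}
         (P? : Decidable P) (Q? : Decidable Q) where

  length-filter-mono : (∀ {x} → P x → Q x) →
                       ∀ xs → length (filter P? xs) ≤ length (filter Q? xs)
  length-filter-mono P⇒Q []       = z≤n
  length-filter-mono P⇒Q (x ∷ xs) with P? x | Q? x
  ... | yes p | yes q = s≤s (length-filter-mono P⇒Q xs)
  ... | yes p | no ¬q = contradiction (P⇒Q p) ¬q
  ... | no ¬p | yes q = ℕ.m≤n⇒m≤1+n (length-filter-mono P⇒Q xs)
  ... | no ¬p | no ¬q = length-filter-mono P⇒Q xs

  filter-cong : ∀ {xs} → All (λ x → (P x → Q x) × (Q x → P x)) xs →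
                filter P? xs ≡ filter Q? xs
  filter-cong [] = refl
  filter-cong {x ∷ _} ((P⇒Q , Q⇒P) ∷ eqs) with P? x | Q? x
  ... | yes p | yes q = cong (x ∷_) (filter-cong eqs)
  ... | yes p | no ¬q = contradiction (P⇒Q p) ¬q
  ... | no ¬p | yes q = contradiction (Q⇒P q) ¬p
  ... | no ¬p | no ¬q = filter-cong eqs

  -- Stated as a permutation because it has two uses: counting components needs only the length, but
  -- factoring one edge out of a product needs the elements.
  filter-drop : ∀ {b} → P b → ¬ Q b → (∀ {x} → x ≢ b → P x → Q x) →
    (∀ {x} → Q x → P x) → ∀ {xs} → Unique xs → b ∈ˡ xs →
    filter P? xs ↭ b ∷ filter Q? xs
  filter-drop Pb ¬Qb P⇒Q Q⇒P {x ∷ xs} (x∉ ∷ xs!) (here refl) with P? x | Q? x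
  ... | yes _ | yes q = contradiction q ¬Qb
  ... | no ¬p | _     = contradiction Pb ¬p
  ... | yes _ | no _  = ↭-reflexive (cong (x ∷_)
    (filter-cong (All.map (λ x≢ → P⇒Q (x≢ ∘ sym) , Q⇒P) x∉)))
  filter-drop Pb ¬Qb P⇒Q Q⇒P {x ∷ xs} (x∉ ∷ xs!) (there b∈) with P? x | Q? x
  ... | yes p | yes q = ↭-trans (↭-prep x (filter-drop Pb ¬Qb P⇒Q Q⇒P xs! b∈))
                                (↭-swap _ _ ↭-refl)
  ... | yes p | no ¬q = contradiction (P⇒Q (All.lookup x∉ b∈) p) ¬q
  ... | no ¬p | yes q = contradiction (Q⇒P q) ¬p
  ... | no ¬p | no ¬q = filter-drop Pb ¬Qb P⇒Q Q⇒P xs! b∈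

-- The number of components under insertion of an edge.

module ComponentLemmas (G : Graph) where
  open Graph G
  open GraphLemmas G

  IsLeast-mono : ∀ {S S′ v} → S ⊆ S′ → IsLeast G S′ v → IsLeast G S v
  IsLeast-mono S⊆ least u l = least u (Linked-mono S⊆ l)

  components-mono : ∀ {S S′} → S ⊆ S′ → components G S′ ≤ components G S
  components-mono {S} {S′} S⊆ =
    length-filter-mono (isLeast? G S′) (isLeast? G S) (IsLeast-mono S⊆) (allFin #V)

  components-cong : ∀ {S S′} → (∀ {u v} → Linked S u v → Linked S′ u v) →
                    (∀ {u v} → Linked S′ u v → Linked S u v) →
                    components G S ≡ components G S′
  components-cong {S} {S′} to from = cong length
    (List.filter-≐ (isLeast? G S) (isLeast? G S′)
      ((λ least u → least u ∘ from) , (λ least u → least u ∘ to)) (allFin #V))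

  components-connected : ∀ {S S′} → IsConnected S → IsConnected S′ →
                         components G S ≡ components G S′
  components-connected c c′ = components-cong (λ _ → c′ _ _) (λ _ → c _ _)

  components-insert-spanned : ∀ {S e} → Spanned S e →
                              components G (S ∪ ⁅ e ⁆) ≡ components G S
  components-insert-spanned s =
    components-cong (Linked-insert-Spanned s) (Linked-mono ∈-insert)

  components-∅ : components G ∅ ≡ #V
  components-∅ = trans
    (cong length (List.filter-all (isLeast? G ∅) (All.universal least (allFin #V))))
    (List.length-tabulate {n = #V} id)
    where
    least : ∀ v → IsLeast G ∅ v
    least v u ε                  = Fin.≤-refl
    least v u ((_ , e∈ , _) ◅ _) = contradiction e∈ ∉⊥

  representative : ∀ S v → ∃ λ r → Linked S r v × IsLeast G S r
  representative S v = go v (Fin-<-wellFounded v)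
    where
    go : ∀ v → Acc Fin._<_ v → ∃ λ r → Linked S r v × IsLeast G S r
    go v (acc rec) with any? (λ u → linked? G S u v ×-dec (u Fin.<? v))
    ... | no none = v , ε , λ u l → ℕ.≮⇒≥ λ u<v → none (u , l , u<v)
    ... | yes (u , l , u<v) with go u (rec u<v)
    ...   | r , l′ , least = r , l′ ◅◅ l , least

  -- The larger of the two representatives a < b stops being one.
  private
    components-merge : ∀ {S e a b} → a Fin.< b → IsLeast G S a → IsLeast G S b →
      Linked (S ∪ ⁅ e ⁆) a b →
      (∀ {x y} → Linked (S ∪ ⁅ e ⁆) x y →
        Linked S x y ⊎ (Linked S x a × Linked S b y) ⊎ (Linked S x b × Linked S a y)) →
      components G S ≡ suc (components G (S ∪ ⁅ e ⁆))
    components-merge {S} {e} {a} {b} a<b least-a least-b l split =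
      ↭-length (filter-drop (isLeast? G S) (isLeast? G (S ∪ ⁅ e ⁆))
        least-b (λ least → ℕ.<⇒≱ a<b (least a l)) to (IsLeast-mono ∈-insert)
        (allFin⁺ #V) (∈-allFin b))
      where
      to : ∀ {w} → w ≢ b → IsLeast G S w → IsLeast G (S ∪ ⁅ e ⁆) w
      to w≢b least u l with split l
      ... | inj₁ p              = least u p
      ... | inj₂ (inj₁ (_ , q)) = contradiction
        (Fin.≤-antisym (least b q) (least-b _ (Linked-sym q))) w≢b
      ... | inj₂ (inj₂ (p , q)) = Fin.≤-trans (least a q)
        (Fin.≤-trans (ℕ.<⇒≤ a<b) (least-b u p))

  components-insert-unspanned : ∀ {S e} → ¬ Spanned S e →
    components G S ≡ suc (components G (S ∪ ⁅ e ⁆))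
  components-insert-unspanned {S} {e} ¬s
    with representative S (end₁ e) | representative S (end₂ e)
  ... | a , la , least-a | b , lb , least-b with Fin.<-cmp a b
  ...   | tri≈ _ refl _ = contradiction (Linked-sym la ◅◅ lb) ¬s
  ...   | tri< a<b _ _ = components-merge a<b least-a least-b link
    (Sum.map₂ (Sum.map (λ (p , q) → p ◅◅ Linked-sym la , lb ◅◅ q)
                       (λ (p , q) → p ◅◅ Linked-sym lb , la ◅◅ q)) ∘ Linked-insert⁻)
    where
    link : Linked (S ∪ ⁅ e ⁆) a b
    link = Linked-mono ∈-insert la ◅◅ ∈⇒Spanned (∈-inserted S) ◅◅
           Linked-mono ∈-insert (Linked-sym lb)
  ...   | tri> _ _ b<a = components-merge b<a least-b least-a link
    (Sum.map₂ (Sum.map (λ (p , q) → p ◅◅ Linked-sym lb , la ◅◅ q)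
                       (λ (p , q) → p ◅◅ Linked-sym la , lb ◅◅ q) ∘ Sum.swap) ∘
     Linked-insert⁻)
    where
    link : Linked (S ∪ ⁅ e ⁆) b a
    link = Linked-mono ∈-insert lb ◅◅ Linked-sym (∈⇒Spanned (∈-inserted S)) ◅◅
           Linked-mono ∈-insert (Linked-sym la)

  subset-induction : ∀ {p} (P : Subset #E → Set p) → P ∅ →
    (∀ {S e} → e ∉ S → P S → P (S ∪ ⁅ e ⁆)) → ∀ S → P S
  subset-induction P P∅ step S = go S (<-wellFounded _)
    where
    go : ∀ S → Acc ℕ._<_ ∣ S ∣ → P S
    go S (acc rec) with nonempty? S
    ... | no empty = subst P (sym (Empty-unique empty)) P∅
    ... | yes (e , e∈) = subst P (delete-insert e∈)
      (step (∉-deleted S e) (go (S - e) (rec (x∈p⇒∣p-x∣<∣p∣ e∈))))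

  components-size-insert-spanned : ∀ {S e} → e ∉ S → Spanned S e →
    components G (S ∪ ⁅ e ⁆) ℕ.+ ∣ S ∪ ⁅ e ⁆ ∣ ≡ suc (components G S ℕ.+ ∣ S ∣)
  components-size-insert-spanned {S} e∉ s = trans
    (cong₂ ℕ._+_ (components-insert-spanned s) (∣insert∣ S e∉)) (ℕ.+-suc _ _)

  components-size-insert-unspanned : ∀ {S e} → e ∉ S → ¬ Spanned S e →
    components G (S ∪ ⁅ e ⁆) ℕ.+ ∣ S ∪ ⁅ e ⁆ ∣ ≡ components G S ℕ.+ ∣ S ∣
  components-size-insert-unspanned {S} {e} e∉ ¬s = trans
    (cong (components G (S ∪ ⁅ e ⁆) ℕ.+_) (∣insert∣ S e∉))
    (trans (ℕ.+-suc _ _) (cong (ℕ._+ ∣ S ∣) (sym (components-insert-unspanned ¬s))))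

  components-size-∅ : components G ∅ ℕ.+ ∣ ∅ {#E} ∣ ≡ #V
  components-size-∅ =
    trans (cong₂ ℕ._+_ components-∅ (∣⊥∣≡0 #E)) (ℕ.+-identityʳ #V)

  -- An insertion raises the size by one and lowers the number of components by at most one. Hence
  -- the truncated subtraction in the exponent of `y - 1` is exact.
  #V≤components+size : ∀ S → #V ≤ components G S ℕ.+ ∣ S ∣
  #V≤components+size =
    subset-induction _ (ℕ.≤-reflexive (sym components-size-∅)) step
    where
    step : ∀ {S e} → e ∉ S → #V ≤ components G S ℕ.+ ∣ S ∣ →
           #V ≤ components G (S ∪ ⁅ e ⁆) ℕ.+ ∣ S ∪ ⁅ e ⁆ ∣
    step {S} {e} e∉ ih with spanned? S e
    ... | yes s = ℕ.≤-trans (ℕ.m≤n⇒m≤1+n ih)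
      (ℕ.≤-reflexive (sym (components-size-insert-spanned e∉ s)))
    ... | no ¬s = ℕ.≤-trans ih
      (ℕ.≤-reflexive (sym (components-size-insert-unspanned e∉ ¬s)))

  -- While a forest is built up, no inserted edge is spanned, so every insertion trades one
  -- component for one edge.
  forest-components+size : ∀ S → Forest S → components G S ℕ.+ ∣ S ∣ ≡ #V
  forest-components+size = subset-induction _ (λ _ → components-size-∅)
    λ {S} e∉ ih F → trans
      (components-size-insert-unspanned e∉ λ s → F (∈-inserted S)
        (Linked-mono (⊆-delete ∈-insert e∉) s))
      (ih (Forest-mono ∈-insert F))

-- Orbits of an injective self-map of a finite set.

module Orbits {n : ℕ} (f : Fin n → Fin n) (f-injective : Injective _≡_ _≡_ f) where

  orbit : Fin n → ℕ → Fin n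
  orbit x = fold x f

  Reach : Fin n → Fin n → Set
  Reach x y = ∃ λ k → orbit x k ≡ y

  orbit-+ : ∀ x j k → orbit x (j ℕ.+ k) ≡ orbit (orbit x k) j
  orbit-+ x j k = fold-+ x f j

  -- `fold` puts the new application outside, `iterate` inside; this passes from one to the other.
  orbit-shift : ∀ x k → orbit (f x) k ≡ orbit x (suc k)
  orbit-shift x zero    = refl
  orbit-shift x (suc k) = cong f (orbit-shift x k)

  orbit-cancel : ∀ x j k → orbit x j ≡ orbit x (j ℕ.+ k) → x ≡ orbit x k
  orbit-cancel x zero    k eq = eq
  orbit-cancel x (suc j) k eq = orbit-cancel x j k (f-injective eq)

  repeat : ∀ x {i j} → i < j → orbit x i ≡ orbit x j → orbit x (j ∸ i) ≡ x
  repeat x {i} {j} i<j eq = sym (orbit-cancel x i (j ∸ i)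
    (trans eq (cong (orbit x) (sym (ℕ.m+[n∸m]≡n (ℕ.<⇒≤ i<j))))))

  period : ∀ x → ∃ λ p → 0 < p × p ≤ n × orbit x p ≡ x
  period x with pigeonhole (ℕ.n<1+n n) (orbit x ∘ toℕ)
  ... | i , j , i<j , eq =
    toℕ j ∸ toℕ i , ℕ.m<n⇒0<n∸m i<j ,
    ℕ.≤-trans (ℕ.m∸n≤m (toℕ j) (toℕ i)) (ℕ.s≤s⁻¹ (toℕ<n j)) , repeat x i<j eq

  Reach-refl : ∀ {x} → Reach x x
  Reach-refl = 0 , refl

  Reach-trans : ∀ {x y z} → Reach x y → Reach y z → Reach x z
  Reach-trans {x} (j , refl) (k , eq) = k ℕ.+ j , trans (orbit-+ x k j) eq

  Reach-step : ∀ {x y} → f x ≡ y → Reach x y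
  Reach-step eq = 1 , eq

  Reach-back : ∀ x → Reach (f x) x
  Reach-back x with period x
  ... | suc p , _ , _ , eq = p , trans (orbit-shift x p) eq

  Reach-sym : ∀ {x y} → Reach x y → Reach y x
  Reach-sym (k , refl) = go k
    where
    go : ∀ {x} k → Reach (orbit x k) x
    go zero    = Reach-refl
    go (suc k) = Reach-trans (Reach-back _) (go k)

  module Cyclic (x : Fin n) (reach : ∀ y → Reach x y) where

    orbit-*-period : ∀ {p} → orbit x p ≡ x → ∀ q → orbit x (q ℕ.* p) ≡ x
    orbit-*-period     eq zero    = refl
    orbit-*-period {p} eq (suc q) =
      trans (orbit-+ x p (q ℕ.* p))
        (trans (cong (λ y → orbit y p) (orbit-*-period eq q)) eq)

    orbit-% : ∀ {p} .{{_ : NonZero p}} → orbit x p ≡ x → ∀ k → orbit x (k % p) ≡ orbit x k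
    orbit-% {p} eq k = sym (trans (cong (orbit x) (m≡m%n+[m/n]*n k p))
      (trans (orbit-+ x (k % p) (k / p ℕ.* p))
             (cong (λ y → orbit y (k % p)) (orbit-*-period eq (k / p)))))

    reach-below : ∀ {p} → 0 < p → orbit x p ≡ x → ∀ y → ∃ λ k → k < p × orbit x k ≡ y
    reach-below {suc p} _ eq y with reach y
    ... | k , refl = k % suc p , m%n<n k (suc p) , orbit-% eq k

    -- With period `p` the orbit of `x` has at most `p` points, yet it is everything.
    n≤period : ∀ {p} → 0 < p → orbit x p ≡ x → n ≤ p
    n≤period {p} 0<p eq = injective⇒≤ {f = index} λ {y} {z} i≡j →
      trans (sym (orbit-index y)) (trans (cong (orbit x ∘ toℕ) i≡j) (orbit-index z))
      where
      index : Fin n → Fin p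
      index y = fromℕ< (proj₁ (proj₂ (reach-below 0<p eq y)))
      orbit-index : ∀ y → orbit x (toℕ (index y)) ≡ y
      orbit-index y = trans
        (cong (orbit x) (toℕ-fromℕ< (proj₁ (proj₂ (reach-below 0<p eq y)))))
        (proj₂ (proj₂ (reach-below 0<p eq y)))

    orbit-n : orbit x n ≡ x
    orbit-n with period x
    ... | p , 0<p , p≤n , eq =
      subst (λ k → orbit x k ≡ x) (ℕ.≤-antisym p≤n (n≤period 0<p eq)) eq

    orbit-distinct : ∀ {i j} → i < j → j < n → orbit x i ≢ orbit x j
    orbit-distinct {i} {j} i<j j<n eq = ℕ.<⇒≱ j<n
      (ℕ.≤-trans (n≤period (ℕ.m<n⇒0<n∸m i<j) (repeat x i<j eq)) (ℕ.m∸n≤m j i))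

    -- Written with the body of `rank`, so that for the motion function from the root the two agree
    -- definitionally.
    position : Fin n → ℕ
    position y = length (takeWhile (λ z → ¬? (z ≟ y)) (iterate f x n))

    private
      length-takeWhile : ∀ {y} k m z → k < m → (∀ {j} → j < k → orbit z j ≢ y) →
        orbit z k ≡ y → length (takeWhile (λ z → ¬? (z ≟ y)) (iterate f z m)) ≡ k
      length-takeWhile {y} zero (suc m) z _ _ eq with z ≟ y
      ... | yes _   = refl
      ... | no  z≢y = contradiction eq z≢y
      length-takeWhile {y} (suc k) (suc m) z (s≤s k<m) ne eq with z ≟ y
      ... | yes z≡y = contradiction z≡y (ne {0} (s≤s z≤n))
      ... | no  _   = cong suc (length-takeWhile k m (f z) k<m
        (λ {j} j<k → ne (s≤s j<k) ∘ trans (sym (orbit-shift z j)))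
        (trans (orbit-shift z k) eq))

    position-orbit : ∀ {k} → k < n → position (orbit x k) ≡ k
    position-orbit {k} k<n =
      length-takeWhile k n x k<n (λ j<k → orbit-distinct j<k k<n) refl

    0<n : 0 < n
    0<n = ℕ.≤-<-trans z≤n (toℕ<n x)

    position<n : ∀ y → position y < n
    position<n y with reach-below 0<n orbit-n y
    ... | k , k<n , refl = subst (_< n) (sym (position-orbit k<n)) k<n

    orbit-position : ∀ y → orbit x (position y) ≡ y
    orbit-position y with reach-below 0<n orbit-n y
    ... | k , k<n , refl = cong (orbit x) (position-orbit k<n)

    position-injective : ∀ {y z} → position y ≡ position z → y ≡ z
    position-injective {y} {z} eq =
      trans (sym (orbit-position y)) (trans (cong (orbit x) eq) (orbit-position z))

-- Half-edges of the embedding and cycles of the motion function.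

module MotionLemmas {G : Graph} (𝒢 : RootedEmbedding G) where
  open Graph G
  open GraphLemmas G
  open ComponentLemmas G using (subset-induction)
  open RootedEmbedding 𝒢

  vert : H → V
  vert = Inverse.to vertexIso

  σ′ : H → H
  σ′ = σ ⟨$⟩ʳ_

  σ-injective : ∀ {g h} → σ′ g ≡ σ′ h → g ≡ h
  σ-injective = Bijection.injective (Inverse⇒Bijection σ)

  vert-σ : ∀ h → vert (σ′ h) ≡ vert h
  vert-σ h = Inverse.to-cong vertexIso (bwd refl ◅ ε)

  vert-injective : ∀ {h h′} → vert h ≡ vert h′ → EqClosure (λ g g′ → σ′ g ≡ g′) h h′
  vert-injective = Bijection.injective (Inverse⇒Bijection vertexIso)

  edgeOf-α : ∀ h → edgeOf (α h) ≡ edgeOf h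
  edgeOf-α h = Inverse.to-cong edgeIso (bwd refl ◅ ε)

  edgeOf-halfOf : ∀ e → edgeOf (halfOf e) ≡ e
  edgeOf-halfOf = Inverse.strictlyInverseˡ edgeIso

  α-cycle : ∀ {h h′} → EqClosure (λ g g′ → α g ≡ g′) h h′ → h′ ≡ h ⊎ h′ ≡ α h
  α-cycle ε = inj₁ refl
  α-cycle (fwd refl ◅ l) = [ inj₂ , inj₁ ∘ (λ p → trans p (α-involutive _)) ]′ (α-cycle l)
  α-cycle (bwd refl ◅ l) =
    [ (λ p → inj₂ (trans p (sym (α-involutive _)))) , inj₁ ]′ (α-cycle l)

  edgeOf-≡ : ∀ {h h′} → edgeOf h ≡ edgeOf h′ → h′ ≡ h ⊎ h′ ≡ α h
  edgeOf-≡ eq = α-cycle (Bijection.injective (Inverse⇒Bijection edgeIso) eq)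

  -- The two directions of `incidence` show that the ends of the edge and the vertices of its halves
  -- form the same set, and two pairs with the same set of entries agree up to order.
  edgeOf-Joins : ∀ h → Joins (edgeOf h) (vert h) (vert (α h))
  edgeOf-Joins h = go (incident h (h , ε , ε)) (incident (α h) (α h , fwd refl ◅ ε , ε))
    (end-half (inj₁ refl)) (end-half (inj₂ refl))
    where
    incident : ∀ g → IncidentCycles h g → Incident (edgeOf h) (vert g)
    incident g = Equivalence.to (incidence h g)

    end-half : ∀ {v} → Incident (edgeOf h) v → v ≡ vert h ⊎ v ≡ vert (α h)
    end-half {v} i with Equivalence.from (incidence h (Inverse.from vertexIso v))
        (subst (Incident (edgeOf h)) (sym (Inverse.strictlyInverseˡ vertexIso v)) i)
    ... | g , h≈g , w≈g with trans (sym (Inverse.strictlyInverseˡ vertexIso v))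
                                   (Inverse.to-cong vertexIso w≈g) | α-cycle h≈g
    ...   | v≡ | inj₁ refl = inj₁ v≡
    ...   | v≡ | inj₂ refl = inj₂ v≡

    go : Incident (edgeOf h) (vert h) → Incident (edgeOf h) (vert (α h)) →
         end₁ (edgeOf h) ≡ vert h ⊎ end₁ (edgeOf h) ≡ vert (α h) →
         end₂ (edgeOf h) ≡ vert h ⊎ end₂ (edgeOf h) ≡ vert (α h) →
         Joins (edgeOf h) (vert h) (vert (α h))
    go (inj₁ p) (inj₂ q) _ _ = inj₁ (cong₂ _,_ (sym p) (sym q))
    go (inj₂ p) (inj₁ q) _ _ = inj₂ (cong₂ _,_ (sym q) (sym p))
    go (inj₁ p) (inj₁ q) _ (inj₁ r) = inj₁ (cong₂ _,_ (sym p) (trans r (trans p (sym q))))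
    go (inj₁ p) (inj₁ q) _ (inj₂ r) = inj₁ (cong₂ _,_ (sym p) r)
    go (inj₂ p) (inj₂ q) (inj₁ r) _ = inj₁ (cong₂ _,_ r (sym q))
    go (inj₂ p) (inj₂ q) (inj₂ r) _ = inj₂ (cong₂ _,_ r (sym p))

  halfOf-Joins : ∀ e → Joins e (vert (halfOf e)) (vert (α (halfOf e)))
  halfOf-Joins e = subst (λ f → Joins f (vert (halfOf e)) (vert (α (halfOf e))))
    (edgeOf-halfOf e) (edgeOf-Joins (halfOf e))

  module _ (S : Subset #E) where

    α-∈ : ∀ {g h} → α g ≡ h → edgeOf g ∈ S → edgeOf h ∈ S
    α-∈ {g} refl = subst (_∈ S) (sym (edgeOf-α g))

    motion-internal : ∀ {h} → edgeOf h ∈ S → motion 𝒢 S h ≡ σ′ (α h)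
    motion-internal {h} e∈ with edgeOf h ∈? S
    ... | yes _ = refl
    ... | no e∉ = contradiction e∈ e∉

    motion-external : ∀ {h} → edgeOf h ∉ S → motion 𝒢 S h ≡ σ′ h
    motion-external {h} e∉ with edgeOf h ∈? S
    ... | yes e∈ = contradiction e∈ e∉
    ... | no _   = refl

    motion-injective : Injective _≡_ _≡_ (motion 𝒢 S)
    motion-injective {g} {h} eq with edgeOf g ∈? S | edgeOf h ∈? S
    ... | no  _  | no  _  = σ-injective eq
    ... | yes _  | yes _  =
      trans (sym (α-involutive g)) (trans (cong α (σ-injective eq)) (α-involutive h))
    -- Equal images under `σ` give `α g ≡ h`: two halves of one edge cannot differ in status.
    ... | yes g∈ | no h∉  = contradiction (α-∈ (σ-injective eq) g∈) h∉
    ... | no g∉  | yes h∈ = contradiction (α-∈ (σ-injective (sym eq)) h∈) g∉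

    open Orbits (motion 𝒢 S) motion-injective public

    motion-linked : ∀ h → Linked S (vert h) (vert (motion 𝒢 S h))
    motion-linked h with edgeOf h ∈? S
    ... | yes e∈ = subst (Linked S (vert h)) (sym (vert-σ (α h)))
      ((edgeOf h , e∈ , edgeOf-Joins h) ◅ ε)
    ... | no  _  = subst (Linked S (vert h)) (sym (vert-σ h)) ε

    Reach⇒Linked : ∀ {h h′} → Reach h h′ → Linked S (vert h) (vert h′)
    Reach⇒Linked (k , refl) = go k
      where
      go : ∀ {h} k → Linked S (vert h) (vert (orbit h k))
      go zero    = ε
      go (suc k) = go k ◅◅ motion-linked _

  -- The motion of S ∪ {e} is that of S composed with the transposition of the
  -- two halves of e, which merges the two cycles containing these halves.
  module Merge {S : Subset #E} {e : E} (e∉ : e ∉ S) (¬s : ¬ Spanned S e) where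
    private
      module Old = Orbits (motion 𝒢 S) (motion-injective S)
      module New = Orbits (motion 𝒢 (S ∪ ⁅ e ⁆)) (motion-injective (S ∪ ⁅ e ⁆))
      t t′ : H → H
      t  = motion 𝒢 (S ∪ ⁅ e ⁆)
      t′ = motion 𝒢 S

    motion-other : ∀ {h} → edgeOf h ≢ e → t h ≡ t′ h
    motion-other {h} ≢e with edgeOf h ∈? S
    ... | yes f∈ = motion-internal (S ∪ ⁅ e ⁆) (∈-insert f∈)
    ... | no  f∉ = motion-external (S ∪ ⁅ e ⁆) ([ f∉ , ≢e ]′ ∘ ∈-insert⁻)

    motion-α : ∀ {h} → edgeOf h ≡ e → t (α h) ≡ t′ h
    motion-α {h} refl = trans
      (motion-internal (S ∪ ⁅ e ⁆) (subst (_∈ S ∪ ⁅ e ⁆) (sym (edgeOf-α h)) (∈-inserted S)))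
      (trans (cong σ′ (α-involutive h)) (sym (motion-external S e∉)))

    -- The new motion takes `α h` to the old successor of `h`. From there the old cycle is followed
    -- until it closes at `h`; it cannot meet `α h`, since `S` does not span `e`, so both motions
    -- agree all the way.
    merged : ∀ {h} → edgeOf h ≡ e → New.Reach (α h) h
    merged {h} refl with Old.Reach-back h
    ... | k , eq =
      New.Reach-trans (New.Reach-step (motion-α refl)) (go k (Old.Reach-step refl) eq)
      where
      go : ∀ {y} k → Old.Reach h y → Old.orbit y k ≡ h → New.Reach y h
      go zero _ refl = New.Reach-refl
      go {y} (suc k) r eq with edgeOf y ≟ e
      ... | no ≢e = New.Reach-trans (New.Reach-step (motion-other ≢e))
        (go k (Old.Reach-trans r (Old.Reach-step refl)) (trans (Old.orbit-shift y k) eq))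
      ... | yes ≡e with edgeOf-≡ (sym ≡e)
      ...   | inj₁ refl = New.Reach-refl
      ...   | inj₂ refl =
        contradiction (Joins⇒Spanned (edgeOf-Joins h) (Reach⇒Linked S r)) ¬s

    old⇒new : ∀ {h h′} → Old.Reach h h′ → New.Reach h h′
    old⇒new (k , refl) = go k
      where
      step : ∀ h → New.Reach h (t′ h)
      step h with edgeOf h ≟ e
      ... | no ≢e  = New.Reach-step (motion-other ≢e)
      ... | yes ≡e =
        New.Reach-trans (New.Reach-sym (merged ≡e)) (New.Reach-step (motion-α ≡e))
      go : ∀ {h} k → New.Reach h (Old.orbit h k)
      go zero    = New.Reach-refl
      go (suc k) = New.Reach-trans (go k) (step _)

    linked⇒new : (∀ {h h′} → Linked S (vert h) (vert h′) → Old.Reach h h′) →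
                 ∀ {h h′} → Linked (S ∪ ⁅ e ⁆) (vert h) (vert h′) → New.Reach h h′
    linked⇒new old {h} {h′} l with Linked-insert⁻ l
    ... | inj₁ p = old⇒new (old p)
    ... | inj₂ s = go s (halfOf-Joins e)
      where
      g : H
      g = halfOf e
      across : New.Reach (α g) g
      across = merged (edgeOf-halfOf e)
      go : (Linked S (vert h) (end₁ e) × Linked S (end₂ e) (vert h′)) ⊎
           (Linked S (vert h) (end₂ e) × Linked S (end₁ e) (vert h′)) →
           Joins e (vert g) (vert (α g)) → New.Reach h h′
      go (inj₁ (p , q)) (inj₁ eq) rewrite eq =
        New.Reach-trans (old⇒new (old p))
          (New.Reach-trans (New.Reach-sym across) (old⇒new (old q)))
      go (inj₁ (p , q)) (inj₂ eq) rewrite eq =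
        New.Reach-trans (old⇒new (old p)) (New.Reach-trans across (old⇒new (old q)))
      go (inj₂ (p , q)) (inj₁ eq) rewrite eq =
        New.Reach-trans (old⇒new (old p)) (New.Reach-trans across (old⇒new (old q)))
      go (inj₂ (p , q)) (inj₂ eq) rewrite eq =
        New.Reach-trans (old⇒new (old p))
          (New.Reach-trans (New.Reach-sym across) (old⇒new (old q)))

  -- Induction on the edges of the forest, starting from `motion ∅`, whose cycles are those of `σ`,
  -- that is, the vertices. For a spanning tree it says that the motion is a single cycle.
  linked⇒Reach : ∀ S → Forest S → ∀ {h h′} → Linked S (vert h) (vert h′) → Reach S h h′
  linked⇒Reach = subset-induction _ base
    λ {S} {e} e∉ ih F → Merge.linked⇒new e∉
      (λ s → F (∈-inserted S) (Linked-mono (⊆-delete ∈-insert e∉) s))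
      (ih (Forest-mono ∈-insert F))
    where
    σ⇒Reach : ∀ {h h′} → EqClosure (λ g g′ → σ′ g ≡ g′) h h′ → Reach ∅ h h′
    σ⇒Reach ε             = Reach-refl ∅
    σ⇒Reach (fwd refl ◅ l) =
      Reach-trans ∅ (Reach-step ∅ (motion-external ∅ ∉⊥)) (σ⇒Reach l)
    σ⇒Reach (bwd refl ◅ l) =
      Reach-trans ∅ (Reach-sym ∅ (Reach-step ∅ (motion-external ∅ ∉⊥))) (σ⇒Reach l)
    base : Forest ∅ → ∀ {h h′} → Linked ∅ (vert h) (vert h′) → Reach ∅ h h′
    base _ l = σ⇒Reach (vert-injective (∅-linked l))
      where
      ∅-linked : ∀ {u v} → Linked ∅ u v → u ≡ v
      ∅-linked ε                  = refl
      ∅-linked ((_ , e∈ , _) ◅ _) = contradiction e∈ ∉⊥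

-- The tour of a spanning tree: interlacing and activity.

module TourLemmas {G : Graph} (𝒢 : RootedEmbedding G) {T : Subset (Graph.#E G)}
                  (tree : Graph.IsSpanningTree G T) where
  open Graph G
  open GraphLemmas G
  open RootedEmbedding 𝒢
  open MotionLemmas 𝒢
  open Cyclic T root (λ h → linked⇒Reach T (tree⇒forest tree) (proj₁ tree _ _))
    public using () renaming
    ( position-orbit to rank-tour; position<n to rank<#H; orbit-position to tour-rank
    ; position-injective to rank-injective; orbit-n to tour-#H)

  tour : ℕ → H
  tour = orbit T root

  r : H → ℕ
  r = rank 𝒢 T

  -- The position at which the backward reading meets `e` for the first time.
  maxRank : E → ℕ
  maxRank e = r (halfOf e) ⊔ r (α (halfOf e))

  halfOf-edgeOf : ∀ h → halfOf (edgeOf h) ≡ h ⊎ halfOf (edgeOf h) ≡ α h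
  halfOf-edgeOf h = edgeOf-≡ (sym (edgeOf-halfOf (edgeOf h)))

  edgeRank-half : ∀ h → edgeRank 𝒢 T (edgeOf h) ≡ r h ⊓ r (α h)
  edgeRank-half h with halfOf-edgeOf h
  ... | inj₁ eq = cong (λ g → r g ⊓ r (α g)) eq
  ... | inj₂ eq = trans (cong (λ g → r g ⊓ r (α g)) eq)
    (trans (cong (λ g → r (α h) ⊓ r g) (α-involutive h)) (ℕ.⊓-comm (r (α h)) (r h)))

  maxRank-half : ∀ h → maxRank (edgeOf h) ≡ r h ⊔ r (α h)
  maxRank-half h with halfOf-edgeOf h
  ... | inj₁ eq = cong (λ g → r g ⊔ r (α g)) eq
  ... | inj₂ eq = trans (cong (λ g → r g ⊔ r (α g)) eq)
    (trans (cong (λ g → r (α h) ⊔ r g) (α-involutive h)) (ℕ.⊔-comm (r (α h)) (r h)))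

  -- For distinct edges this excludes only that the halves of one are nested between the halves of
  -- the other.
  SameOrder : E → E → Set
  SameOrder e f = (edgeRank 𝒢 T e < edgeRank 𝒢 T f × maxRank e < maxRank f) ⊎
                  (edgeRank 𝒢 T f < edgeRank 𝒢 T e × maxRank f < maxRank e)

  SameOrder-sym : ∀ {e f} → SameOrder e f → SameOrder f e
  SameOrder-sym = Sum.swap

  -- The tour leaves the component of the root in T - i through the half c of
  -- i and comes back to it through α c.
  module Sides {c : H} (i∈ : edgeOf c ∈ T)
    (in-c : Linked (T - edgeOf c) (vert root) (vert c))
    (out-αc : ¬ Linked (T - edgeOf c) (vert root) (vert (α c))) where

    i : E
    i = edgeOf c

    Near : H → Set
    Near h = Linked (T - i) (vert root) (vert h)

    near-motion : ∀ {h} → h ≢ c → h ≢ α c →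
                  Linked (T - i) (vert h) (vert (motion 𝒢 T h))
    near-motion {h} h≢c h≢αc with edgeOf h ∈? T
    ... | no  _  = subst (Linked (T - i) (vert h)) (sym (vert-σ h)) ε
    ... | yes e∈ = subst (Linked (T - i) (vert h)) (sym (vert-σ (α h)))
      ((edgeOf h , ∈-delete⁺ e∈ e≢i , edgeOf-Joins h) ◅ ε)
      where
      e≢i : edgeOf h ≢ i
      e≢i eq = [ h≢c , h≢αc ]′ (edgeOf-≡ (sym eq))

    exit : vert (motion 𝒢 T c) ≡ vert (α c)
    exit = trans (cong vert (motion-internal T i∈)) (vert-σ (α c))

    entrance : vert (motion 𝒢 T (α c)) ≡ vert c
    entrance = trans
      (cong vert (motion-internal T (subst (_∈ T) (sym (edgeOf-α c)) i∈)))
      (trans (vert-σ (α (α c))) (cong vert (α-involutive c)))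

    tour-≢ : ∀ {j h} → j < #H → j ≢ r h → tour j ≢ h
    tour-≢ j< j≢ refl = j≢ (sym (rank-tour j<))

    -- The tour changes sides only at `c` and `α c`; before `c` it is on the near side, where it
    -- cannot be at `α c`.
    near-before : ∀ j → j ≤ r c → Near (tour j)
    near-before zero    _    = ε
    near-before (suc j) j<rc = before ◅◅ near-motion
      (tour-≢ (ℕ.<-trans j<rc (rank<#H c)) (ℕ.<⇒≢ j<rc))
      (λ eq → out-αc (subst Near eq before))
      where
      before : Near (tour j)
      before = near-before j (ℕ.<⇒≤ j<rc)

    exit<entrance : r c < r (α c)
    exit<entrance = ℕ.≰⇒> λ ≤rc →
      out-αc (subst Near (tour-rank (α c)) (near-before _ ≤rc))

    -- Nearness would propagate back to the step just after `c`, which is at the vertex of `α c`.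
    far-between : ∀ j → r c < j → j ≤ r (α c) → ¬ Near (tour j)
    far-between (suc j) (s≤s rc≤j) j<rαc near with ℕ.m≤n⇒m<n∨m≡n rc≤j
    ... | inj₂ refl = out-αc
      (subst (Linked (T - i) (vert root))
             (trans (cong (vert ∘ motion 𝒢 T) (tour-rank c)) exit) near)
    ... | inj₁ rc<j = far-between j rc<j (ℕ.<⇒≤ j<rαc) (near ◅◅ Linked-sym
      (near-motion (tour-≢ j<#H (ℕ.>⇒≢ rc<j)) (tour-≢ j<#H (ℕ.<⇒≢ j<rαc))))
      where
      j<#H : j < #H
      j<#H = ℕ.<-trans j<rαc (rank<#H (α c))

    near-after : ∀ j → r (α c) < j → j < #H → Near (tour j)
    near-after (suc j) (s≤s rαc≤j) j<#H with ℕ.m≤n⇒m<n∨m≡n rαc≤j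
    ... | inj₂ refl = subst (Linked (T - i) (vert root))
      (sym (trans (cong (vert ∘ motion 𝒢 T) (tour-rank (α c))) entrance)) in-c
    ... | inj₁ rαc<j = near-after j rαc<j j<#H′ ◅◅ near-motion
      (tour-≢ j<#H′ (ℕ.>⇒≢ (ℕ.<-trans exit<entrance rαc<j)))
      (tour-≢ j<#H′ (ℕ.>⇒≢ rαc<j))
      where
      j<#H′ : j < #H
      j<#H′ = ℕ.<-trans (ℕ.n<1+n j) j<#H

    -- The far half `α a` falls strictly between `c` and `α c`, the near half `a` outside. If `a`
    -- precedes `c`, both comparisons go one way; if it follows `α c`, both go the other way.
    sameOrder : ∀ {a} → edgeOf a ≢ i → Near a → ¬ Near (α a) → SameOrder (edgeOf a) i
    sameOrder {a} ≢i near far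
      rewrite edgeRank-half a | maxRank-half a | edgeRank-half c | maxRank-half c
            | ℕ.m≤n⇒m⊓n≡m (ℕ.<⇒≤ exit<entrance) | ℕ.m≤n⇒m⊔n≡n (ℕ.<⇒≤ exit<entrance)
      with ℕ.<-≤-connex (r a) (r c)
    ... | inj₁ ra<rc = inj₁
      ( ℕ.≤-<-trans (ℕ.m⊓n≤m _ _) ra<rc
      , ℕ.⊔-lub (ℕ.<-trans (ℕ.<-trans ra<rc rc<rαa) rαa<rαc) rαa<rαc)
      where
      rc<rαa : r c < r (α a)
      rc<rαa = ℕ.≰⇒> λ ≤rc → far (subst Near (tour-rank (α a)) (near-before _ ≤rc))
      rαa<rαc : r (α a) < r (α c)
      rαa<rαc = ℕ.≤∧≢⇒<
        (ℕ.≮⇒≥ λ rαc< → far (subst Near (tour-rank (α a)) (near-after _ rαc< (rank<#H _))))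
        λ eq → ≢i (trans (sym (edgeOf-α a))
                  (trans (cong edgeOf (rank-injective eq)) (edgeOf-α c)))
    ... | inj₂ rc≤ra = inj₂
      ( ℕ.⊓-glb rc<ra rc<rαa
      , ℕ.<-≤-trans rαc<ra (ℕ.m≤m⊔n _ _))
      where
      rc<rαa : r c < r (α a)
      rc<rαa = ℕ.≰⇒> λ ≤rc → far (subst Near (tour-rank (α a)) (near-before _ ≤rc))
      rc<ra : r c < r a
      rc<ra = ℕ.≤∧≢⇒< rc≤ra (≢i ∘ sym ∘ cong edgeOf ∘ rank-injective)
      rαc<ra : r (α c) < r a
      rαc<ra = ℕ.≰⇒> λ ≤rαc →
        far-between _ rc<ra ≤rαc (subst Near (sym (tour-rank a)) near)

  -- The halves of i and x alternate along the tour, since the far side of i is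
  -- visited in one go and contains exactly one half of x.
  interlaced : ∀ {i x} → i ∈ T → x ∉ T → ¬ Spanned (T - i) x → SameOrder x i
  interlaced {i} {x} i∈ x∉ ¬s
    with orient i (tree⇒forest tree i∈) | orient x ¬s
    where
    Near : V → Set
    Near = Linked (T - i) (vert root)

    orient : ∀ e → ¬ Spanned (T - i) e →
             ∃ λ h → edgeOf h ≡ e × Near (vert h) × ¬ Near (vert (α h))
    orient e ¬se
      with linked? G (T - i) (vert root) (vert (halfOf e))
         | linked? G (T - i) (vert root) (vert (α (halfOf e)))
         | halfOf-Joins e
    ... | yes p | yes q | j = contradiction (Joins⇒Spanned j (Linked-sym p ◅◅ q)) ¬se
    ... | yes p | no ¬q | _ = halfOf e , edgeOf-halfOf e , p , ¬q
    ... | no ¬p | yes q | _ =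
      α (halfOf e) , trans (edgeOf-α (halfOf e)) (edgeOf-halfOf e) , q ,
      subst (λ h → ¬ Near (vert h)) (sym (α-involutive (halfOf e))) ¬p
    -- Impossible: `T - i` has only one component besides that of the root, so two far halves would
    -- be linked and `e` spanned.
    ... | no ¬p | no ¬q | j = contradiction
      (both-far (Linked-insert⁻ (connected (vert (halfOf e))))
                (Linked-insert⁻ (connected (vert (α (halfOf e)))))) ¬se
      where
      connected : ∀ v → Linked ((T - i) ∪ ⁅ i ⁆) (vert root) v
      connected v = Linked-mono (⊆-insert-delete T i) (proj₁ tree (vert root) v)

      Split : V → Set
      Split v = Near v ⊎ (Near (end₁ i) × Linked (T - i) (end₂ i) v) ⊎
                (Near (end₂ i) × Linked (T - i) (end₁ i) v)

      both-far : Split (vert (halfOf e)) → Split (vert (α (halfOf e))) →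
                 Spanned (T - i) e
      both-far (inj₁ p) _ = contradiction p ¬p
      both-far _ (inj₁ q) = contradiction q ¬q
      both-far (inj₂ (inj₁ (_ , p))) (inj₂ (inj₁ (_ , q))) =
        Joins⇒Spanned j (Linked-sym p ◅◅ q)
      both-far (inj₂ (inj₁ (_ , p))) (inj₂ (inj₂ (p′ , _))) =
        contradiction (p′ ◅◅ p) ¬p
      both-far (inj₂ (inj₂ (_ , p))) (inj₂ (inj₁ (p′ , _))) =
        contradiction (p′ ◅◅ p) ¬p
      both-far (inj₂ (inj₂ (_ , p))) (inj₂ (inj₂ (_ , q))) =
        Joins⇒Spanned j (Linked-sym p ◅◅ q)
  ... | c , refl , in-c , out-αc | a , refl , in-a , out-αa =
    Sides.sameOrder i∈ in-c out-αc (λ eq → x∉ (subst (_∈ T) (sym eq) i∈)) in-a out-αa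

  edgeRank≤⇒maxRank< : ∀ {e f} → SameOrder e f → edgeRank 𝒢 T e ≤ edgeRank 𝒢 T f →
                       maxRank e < maxRank f
  edgeRank≤⇒maxRank< (inj₁ (_ , lt)) _  = lt
  edgeRank≤⇒maxRank< (inj₂ (lt , _)) le = contradiction le (ℕ.<⇒≱ lt)

  maxRank<⇒edgeRank≤ : ∀ {e f} → SameOrder e f → maxRank e < maxRank f →
                       edgeRank 𝒢 T e ≤ edgeRank 𝒢 T f
  maxRank<⇒edgeRank≤ (inj₁ (le , _)) _  = ℕ.<⇒≤ le
  maxRank<⇒edgeRank≤ (inj₂ (_ , gt)) lt = contradiction gt (ℕ.<⇒≯ lt)

  module _ {A : Subset #E} {e : E} (A⊆T : A ⊆ T) (e∉ : e ∉ T)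
           (visited⇒ : ∀ {f} → f ∈ A → maxRank e < maxRank f)
           (visited⇐ : ∀ {f} → f ∈ T → maxRank e < maxRank f → f ∈ A) where

    -- A tree edge outside `A` can be removed with `e` still spanned, so apart from `e` the
    -- fundamental cycle lies in `A`, whose edges all have larger `maxRank`; interlacing turns this
    -- into a comparison of `edgeRank`.
    spanned⇒externallyActive : Spanned A e → ExternallyActive 𝒢 T e
    spanned⇒externallyActive s = e∉ , minimal
      where
      minimal : ∀ f → FundamentalCycle 𝒢 T e f → edgeRank 𝒢 T e ≤ edgeRank 𝒢 T f
      minimal f t′ with f ≟ e
      ... | yes refl = ℕ.≤-refl
      ... | no f≢e with fundamentalCycle⁻ tree e∉ t′ f≢e | f ∈? A
      ...   | f∈ , ¬s | yes f∈A = maxRank<⇒edgeRank≤ (interlaced f∈ e∉ ¬s) (visited⇒ f∈A)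
      ...   | f∈ , ¬s | no  f∉A = contradiction (Linked-mono (⊆-delete A⊆T f∉A) s) ¬s

    -- Otherwise some edge of the fundamental cycle lies outside `A`; minimality of `e` would give
    -- it the larger `maxRank` and so place it in `A`.
    externallyActive⇒spanned : ExternallyActive 𝒢 T e → Spanned A e
    externallyActive⇒spanned (_ , minimal) = decidable-stable (spanned? A e) absurd
      where
      absurd : ¬ ¬ Spanned A e
      absurd ¬s with separating-edge (tree⇒forest tree) A⊆T (proj₁ tree _ _) ¬s
      ... | f , f∈ , f∉A , ¬sf = f∉A (visited⇐ f∈
        (edgeRank≤⇒maxRank< (interlaced f∈ e∉ ¬sf) (minimal f
          (subst IsSpanningTree (sym (insert-delete-comm T λ { refl → e∉ f∈ }))
                 (exchange tree f∈ ¬sf)))))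

  module _ {C : Subset #E} {e : E} (T⊆C : T ⊆ C) (e∈ : e ∈ T)
           (visited⇒ : ∀ {f} → f ∉ C → maxRank e < maxRank f)
           (visited⇐ : ∀ {f} → f ∉ T → maxRank e < maxRank f → f ∉ C) where

    -- An edge `f ≢ e` of `C` in the fundamental cocycle would yield a tree `(T - e) ∪ ⁅ f ⁆` inside
    -- `C - e`, which would span `e`. So the rest of the cocycle lies outside `C`.
    unspanned⇒internallyActive : ¬ Spanned (C - e) e → InternallyActive 𝒢 T e
    unspanned⇒internallyActive ¬s = e∈ , minimal
      where
      minimal : ∀ f → FundamentalCocycle 𝒢 T e f → edgeRank 𝒢 T e ≤ edgeRank 𝒢 T f
      minimal f t′ with f ≟ e
      ... | yes refl = ℕ.≤-refl
      ... | no f≢e with fundamentalCocycle⁻ tree e∈ t′ f≢e | f ∈? C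
      ...   | f∉ , ¬sf | no  f∉C =
        maxRank<⇒edgeRank≤ (SameOrder-sym (interlaced e∈ f∉ ¬sf)) (visited⇒ f∉C)
      ...   | f∉ , ¬sf | yes f∈C = contradiction
        (Linked-mono (insert-⊆ (delete-mono T⊆C) (∈-delete⁺ f∈C f≢e))
                     (proj₁ t′ _ _)) ¬s

    -- A path in `C - e` around `e` crosses the cocycle at some edge of `C`, while minimality of `e`
    -- would put that edge outside `C`.
    internallyActive⇒unspanned : InternallyActive 𝒢 T e → ¬ Spanned (C - e) e
    internallyActive⇒unspanned (_ , minimal) s
      with reconnecting-edge s (tree⇒forest tree e∈)
    ... | f , f∈ , ¬sf = visited⇐ f∉
      (edgeRank≤⇒maxRank< (SameOrder-sym (interlaced e∈ f∉ ¬sf))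
        (minimal f (exchange tree e∈ ¬sf))) (∈-delete⁻ f∈)
      where
      f∉ : f ∉ T
      f∉ f∈T = ¬sf (∈⇒Spanned (∈-delete⁺ f∈T (∈-delete⇒≢ f∈)))

-- Sums over intervals of subsets and products over lists.

module RingSums {c ℓ} (R : CommutativeRing c ℓ) where
  open CommutativeRing R hiding (zero; _-_)
    renaming (refl to ≈-refl; sym to ≈-sym; trans to ≈-trans)
  open import Relation.Binary.Reasoning.Setoid setoid
  open Algebra.Properties.Semiring.Exp semiring using (_^_)
  open Algebra.Properties.CommutativeSemigroup +-commutativeSemigroup
    using () renaming (interchange to +-interchange)
  open Algebra.Properties.CommutativeSemigroup *-commutativeSemigroup
    using () renaming (interchange to *-interchange; x∙yz≈y∙xz to x*yz≈y*xz)

  private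
    variable
      a : Level
      X : Set a
      n : ℕ

  sumOver-++ : ∀ (xs ys : List X) f →
               sumOver R (xs ++ ys) f ≈ sumOver R xs f + sumOver R ys f
  sumOver-++ []       ys f = ≈-sym (+-identityˡ _)
  sumOver-++ (x ∷ xs) ys f =
    ≈-trans (+-congˡ (sumOver-++ xs ys f)) (≈-sym (+-assoc _ _ _))

  sumOver-map : ∀ {b} {Y : Set b} (g : Y → X) ys f →
                sumOver R (map g ys) f ≡ sumOver R ys (f ∘ g)
  sumOver-map g []       f = refl
  sumOver-map g (y ∷ ys) f = cong (f (g y) +_) (sumOver-map g ys f)

  -- The default value is neutral for the intended use: `when` makes factors, `on` makes summands.
  _when_ _on_ : ∀ {p} {P : Set p} → Carrier → Dec P → Carrier
  z when P? = if does P? then z else 1#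
  z on   P? = if does P? then z else 0#

  on-yes : ∀ {p} {P : Set p} {z} (P? : Dec P) → P → z on P? ≈ z
  on-yes (yes _) _ = ≈-refl
  on-yes (no ¬p) p = contradiction p ¬p

  on-no : ∀ {p} {P : Set p} {z} (P? : Dec P) → ¬ P → z on P? ≈ 0#
  on-no (yes p) ¬p = contradiction p ¬p
  on-no (no _)  _  = ≈-refl

  on-scale : ∀ {p} {P : Set p} {k z z′} (P? : Dec P) →
             (P → z ≈ k * z′) → z on P? ≈ k * (z′ on P?)
  on-scale         (yes p) eq = eq p
  on-scale {k = k} (no _)  _  = ≈-sym (zeroʳ k)

  on-cong : ∀ {p} {P : Set p} {z z′} (P? : Dec P) → z ≈ z′ → z on P? ≈ z′ on P?
  on-cong (yes _) eq = eq
  on-cong (no _)  _  = ≈-refl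

  when-yes : ∀ {p} {P : Set p} z (P? : Dec P) → P → z when P? ≈ z
  when-yes z (yes _) _ = ≈-refl
  when-yes z (no ¬p) p = contradiction p ¬p

  when-no : ∀ {p} {P : Set p} z (P? : Dec P) → ¬ P → z when P? ≈ 1#
  when-no z (yes p) ¬p = contradiction p ¬p
  when-no z (no _)  _  = ≈-refl

  sumOver-filter : ∀ {p} {P : Pred X p} (P? : Decidable P) xs f →
    sumOver R (filter P? xs) f ≈ sumOver R xs (λ x → f x on P? x)
  sumOver-filter P? []       f = ≈-refl
  sumOver-filter P? (x ∷ xs) f with P? x
  ... | yes _ = +-congˡ (sumOver-filter P? xs f)
  ... | no  _ = ≈-trans (sumOver-filter P? xs f) (≈-sym (+-identityˡ _))

  -- The sum of f over all S with A ⊆ S ⊆ C (0 unless A ⊆ C).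
  intervalSum : Subset n → Subset n → (Subset n → Carrier) → Carrier
  intervalSum []            []            f = f []
  intervalSum (outside ∷ A) (outside ∷ C) f = intervalSum A C (f ∘ (outside ∷_))
  intervalSum (outside ∷ A) (inside  ∷ C) f =
    intervalSum A C (f ∘ (outside ∷_)) + intervalSum A C (f ∘ (inside ∷_))
  intervalSum (inside  ∷ A) (outside ∷ C) f = 0#
  intervalSum (inside  ∷ A) (inside  ∷ C) f = intervalSum A C (f ∘ (inside ∷_))

  sumOver-subsets : ∀ n f → sumOver R (subsets n) f ≈ intervalSum {n} ∅ ⊤ f
  sumOver-subsets zero    f = +-identityʳ _
  sumOver-subsets (suc n) f = begin
    sumOver R (map (outside ∷_) (subsets n) ++ map (inside ∷_) (subsets n)) f
      ≈⟨ sumOver-++ (map (outside ∷_) (subsets n)) _ f ⟩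
    sumOver R (map (outside ∷_) (subsets n)) f + sumOver R (map (inside ∷_) (subsets n)) f
      ≡⟨ cong₂ _+_ (sumOver-map _ (subsets n) f) (sumOver-map _ (subsets n) f) ⟩
    sumOver R (subsets n) (f ∘ (outside ∷_)) + sumOver R (subsets n) (f ∘ (inside ∷_))
      ≈⟨ +-cong (sumOver-subsets n _) (sumOver-subsets n _) ⟩
    intervalSum ∅ ⊤ (f ∘ (outside ∷_)) + intervalSum ∅ ⊤ (f ∘ (inside ∷_)) ∎

  intervalSum-cong : ∀ (A C : Subset n) {f g} →
    (∀ S → A ⊆ S → S ⊆ C → f S ≈ g S) → intervalSum A C f ≈ intervalSum A C g
  intervalSum-cong []            []            f≈g = f≈g [] id id
  intervalSum-cong (outside ∷ A) (outside ∷ C) f≈g =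
    intervalSum-cong A C λ S A⊆ ⊆C → f≈g _ (out⊆ A⊆) (out⊆ ⊆C)
  intervalSum-cong (outside ∷ A) (inside  ∷ C) f≈g = +-cong
    (intervalSum-cong A C λ S A⊆ ⊆C → f≈g _ (out⊆ A⊆) (out⊆ ⊆C))
    (intervalSum-cong A C λ S A⊆ ⊆C → f≈g _ (out⊆ A⊆) (s⊆s ⊆C))
  intervalSum-cong (inside  ∷ A) (outside ∷ C) f≈g = ≈-refl
  intervalSum-cong (inside  ∷ A) (inside  ∷ C) f≈g =
    intervalSum-cong A C λ S A⊆ ⊆C → f≈g _ (s⊆s A⊆) (s⊆s ⊆C)

  intervalSum-*ˡ : ∀ k (A C : Subset n) f →
                   intervalSum A C (λ S → k * f S) ≈ k * intervalSum A C f
  intervalSum-*ˡ k []            []            f = ≈-refl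
  intervalSum-*ˡ k (outside ∷ A) (outside ∷ C) f = intervalSum-*ˡ k A C _
  intervalSum-*ˡ k (outside ∷ A) (inside  ∷ C) f = ≈-trans
    (+-cong (intervalSum-*ˡ k A C _) (intervalSum-*ˡ k A C _)) (≈-sym (distribˡ k _ _))
  intervalSum-*ˡ k (inside  ∷ A) (outside ∷ C) f = ≈-sym (zeroʳ k)
  intervalSum-*ˡ k (inside  ∷ A) (inside  ∷ C) f = intervalSum-*ˡ k A C _

  intervalSum-scale : ∀ k (A C : Subset n) {f g} →
    (∀ S → A ⊆ S → S ⊆ C → f S ≈ k * g S) → intervalSum A C f ≈ k * intervalSum A C g
  intervalSum-scale k A C eq = ≈-trans (intervalSum-cong A C eq) (intervalSum-*ˡ k A C _)

  intervalSum-zero : ∀ (A C : Subset n) {f} →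
    (∀ S → A ⊆ S → S ⊆ C → f S ≈ 0#) → intervalSum A C f ≈ 0#
  intervalSum-zero A C {f} eq = ≈-trans
    (intervalSum-scale 0# A C {g = f} λ S p q → ≈-trans (eq S p q) (≈-sym (zeroˡ _)))
    (zeroˡ _)

  intervalSum-singleton : ∀ (A : Subset n) f → intervalSum A A f ≈ f A
  intervalSum-singleton []            f = ≈-refl
  intervalSum-singleton (outside ∷ A) f = intervalSum-singleton A _
  intervalSum-singleton (inside  ∷ A) f = intervalSum-singleton A _

  private
    split-≔ : ∀ (A C : Subset n) e f → e ∉ A → e ∈ C →
      intervalSum A C f ≈
      intervalSum A (C [ e ]≔ outside) f + intervalSum (A [ e ]≔ inside) C f
    split-≔ (inside  ∷ A) _             zero    f e∉ _ = contradiction here e∉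
    split-≔ (outside ∷ A) (inside ∷ C)  zero    f _ here = ≈-refl
    split-≔ (outside ∷ A) (outside ∷ C) (suc e) f e∉ (there e∈) =
      split-≔ A C e _ (e∉ ∘ there) e∈
    split-≔ (outside ∷ A) (inside ∷ C)  (suc e) f e∉ (there e∈) = ≈-trans
      (+-cong (split-≔ A C e _ (e∉ ∘ there) e∈) (split-≔ A C e _ (e∉ ∘ there) e∈))
      (+-interchange _ _ _ _)
    split-≔ (inside ∷ A)  (outside ∷ C) (suc e) f e∉ (there e∈) = ≈-sym (+-identityˡ 0#)
    split-≔ (inside ∷ A)  (inside ∷ C)  (suc e) f e∉ (there e∈) =
      split-≔ A C e _ (e∉ ∘ there) e∈

    insert-≔ : ∀ (A C : Subset n) e f → e ∉ A → e ∈ C →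
      intervalSum (A [ e ]≔ inside) C f ≈
      intervalSum A (C [ e ]≔ outside) (λ S → f (S [ e ]≔ inside))
    insert-≔ (inside  ∷ A) _             zero    f e∉ _ = contradiction here e∉
    insert-≔ (outside ∷ A) (inside ∷ C)  zero    f _ here = ≈-refl
    insert-≔ (outside ∷ A) (outside ∷ C) (suc e) f e∉ (there e∈) =
      insert-≔ A C e _ (e∉ ∘ there) e∈
    insert-≔ (outside ∷ A) (inside ∷ C)  (suc e) f e∉ (there e∈) =
      +-cong (insert-≔ A C e _ (e∉ ∘ there) e∈) (insert-≔ A C e _ (e∉ ∘ there) e∈)
    insert-≔ (inside ∷ A)  (outside ∷ C) (suc e) f e∉ (there e∈) = ≈-refl
    insert-≔ (inside ∷ A)  (inside ∷ C)  (suc e) f e∉ (there e∈) =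
      insert-≔ A C e _ (e∉ ∘ there) e∈

  intervalSum-split : ∀ (A C : Subset n) {e} f → e ∉ A → e ∈ C →
    intervalSum A C f ≈ intervalSum A (C - e) f + intervalSum (A ∪ ⁅ e ⁆) C f
  intervalSum-split A C {e} f e∉ e∈ with split-≔ A C e f e∉ e∈
  ... | eq rewrite ≔-delete C e | ≔-insert A e = eq

  -- Reindexes the sets containing `e` by removing `e`, so that they can be compared one by one with
  -- the sets avoiding it.
  intervalSum-insert : ∀ (A C : Subset n) {e} f → e ∉ A → e ∈ C →
    intervalSum (A ∪ ⁅ e ⁆) C f ≈ intervalSum A (C - e) (λ S → f (S ∪ ⁅ e ⁆))
  intervalSum-insert A C {e} f e∉ e∈ with insert-≔ A C e f e∉ e∈
  ... | eq rewrite ≔-delete C e | ≔-insert A e = ≈-trans eq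
    (intervalSum-cong A (C - e) λ S _ _ → reflexive (cong f (≔-insert S e)))

  prodOver : List X → (X → Carrier) → Carrier
  prodOver xs w = foldr _*_ 1# (map w xs)

  prodOver-↭ : ∀ {xs ys : List X} w → xs ↭ ys → prodOver xs w ≈ prodOver ys w
  prodOver-↭ w ↭.refl         = ≈-refl
  prodOver-↭ w (↭.prep x p)   = *-congˡ (prodOver-↭ w p)
  prodOver-↭ w (↭.swap x y p) =
    ≈-trans (*-congˡ (*-congˡ (prodOver-↭ w p))) (x*yz≈y*xz _ _ _)
  prodOver-↭ w (↭.trans p q)  = ≈-trans (prodOver-↭ w p) (prodOver-↭ w q)

  ^-length-filter : ∀ {p} {P : Pred X p} (P? : Decidable P) z xs →
    z ^ length (filter P? xs) ≈ prodOver xs (λ e → z when P? e)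
  ^-length-filter P? z []       = ≈-refl
  ^-length-filter P? z (x ∷ xs) with P? x
  ... | yes _ = *-congˡ (^-length-filter P? z xs)
  ... | no  _ = ≈-trans (^-length-filter P? z xs) (≈-sym (*-identityˡ _))

  prodOver-* : ∀ (xs : List X) v w →
    prodOver xs v * prodOver xs w ≈ prodOver xs (λ x → v x * w x)
  prodOver-* []       v w = *-identityˡ 1#
  prodOver-* (x ∷ xs) v w =
    ≈-trans (*-interchange _ _ _ _) (*-congˡ (prodOver-* xs v w))

-- Deletion-contraction along the backward tour.

module _ {c ℓ} (R : CommutativeRing c ℓ) {G : Graph} (𝒢 : RootedEmbedding G)
         (x y : CommutativeRing.Carrier R) where
  open CommutativeRing R hiding (zero)
    renaming (_-_ to _-ᴿ_; refl to ≈-refl; sym to ≈-sym; trans to ≈-trans)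
  open import Relation.Binary.Reasoning.Setoid setoid
  open Algebra.Properties.Semiring.Exp semiring using (_^_; ^-congʳ)
  open Algebra.Properties.CommutativeSemigroup *-commutativeSemigroup
    using () renaming (x∙yz≈y∙xz to x*yz≈y*xz)
  open RingSums R
  open Graph G
  open GraphLemmas G
  open ComponentLemmas G
  open RootedEmbedding 𝒢
  open MotionLemmas 𝒢

  term : Subset #E → Carrier
  term S = (x -ᴿ 1#) ^ (components G S ∸ components G ⊤) *
           (y -ᴿ 1#) ^ ((components G S ℕ.+ ∣ S ∣) ∸ #V)

  -- The components stay the same and the size grows by one, so only the exponent of `y - 1`
  -- changes.
  term-insert-spanned : ∀ {S e} → e ∉ S → Spanned S e →
                        term (S ∪ ⁅ e ⁆) ≈ (y -ᴿ 1#) * term S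
  term-insert-spanned {S} {e} e∉ s = ≈-trans
    (*-cong (^-congʳ (x -ᴿ 1#) (cong (_∸ components G ⊤) (components-insert-spanned s)))
            (^-congʳ (y -ᴿ 1#) (trans
              (cong (_∸ #V) (components-size-insert-spanned e∉ s))
              (ℕ.+-∸-assoc 1 (#V≤components+size S)))))
    (x*yz≈y*xz _ _ _)

  -- One component is traded for one edge, so only the exponent of `x - 1` changes.
  term-insert-unspanned : ∀ {S e} → e ∉ S → ¬ Spanned S e →
                          term S ≈ (x -ᴿ 1#) * term (S ∪ ⁅ e ⁆)
  term-insert-unspanned {S} {e} e∉ ¬s = ≈-trans
    (*-cong (^-congʳ (x -ᴿ 1#) (trans
              (cong (_∸ components G ⊤) (components-insert-unspanned ¬s))
              (ℕ.+-∸-assoc 1 (components-mono (⊆-max (S ∪ ⁅ e ⁆))))))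
            (^-congʳ (y -ᴿ 1#)
              (cong (_∸ #V) (sym (components-size-insert-unspanned e∉ ¬s)))))
    (*-assoc _ _ _)

  term-tree : IsConnected ⊤ → ∀ {T} → IsSpanningTree T → term T ≈ 1#
  term-tree conn {T} tree = ≈-trans
    (*-cong (^-congʳ (x -ᴿ 1#) (ℕ.m≤n⇒m∸n≡0 (ℕ.≤-reflexive
               (components-connected (proj₁ tree) conn))))
            (^-congʳ (y -ᴿ 1#) (ℕ.m≤n⇒m∸n≡0 (ℕ.≤-reflexive
               (forest-components+size T (tree⇒forest tree))))))
    (*-identityˡ 1#)

  -- At most one factor differs from 1, since internal activity requires `e ∈ T` and external
  -- activity `e ∉ T`.
  activity : Subset #E → E → Carrier
  activity T e = (x when internallyActive? 𝒢 T e) * (y when externallyActive? 𝒢 T e)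

  undecided? : ∀ (A C : Subset #E) → Decidable (λ e → e ∈ C × e ∉ A)
  undecided? A C e = (e ∈? C) ×-dec ¬? (e ∈? A)

  -- Only undecided edges contribute: the factors of decided ones have been taken out of the sum.
  -- Activities still refer to `T` in the whole of `G`.
  weight : Subset #E → Subset #E → Subset #E → Carrier
  weight A C T = prodOver (filter (undecided? A C) (allFin #E)) (activity T)

  treeTerm : Subset #E → Subset #E → Subset #E → Carrier
  treeTerm A C S = weight A C S on isSpanningTree? G S

  weight-delete : ∀ {A C e} T → e ∉ A → e ∈ C →
                  weight A C T ≈ activity T e * weight A (C - e) T
  weight-delete {A} {C} {e} T e∉ e∈ = prodOver-↭ (activity T)
    (filter-drop (undecided? A C) (undecided? A (C - e))
      (e∈ , e∉) (∉-deleted C e ∘ proj₁)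
      (λ ≢e (f∈ , f∉) → ∈-delete⁺ f∈ ≢e , f∉) (λ (f∈ , f∉) → ∈-delete⁻ f∈ , f∉)
      (allFin⁺ #E) (∈-allFin e))

  weight-insert : ∀ {A C e} T → e ∉ A → e ∈ C →
                  weight A C T ≈ activity T e * weight (A ∪ ⁅ e ⁆) C T
  weight-insert {A} {C} {e} T e∉ e∈ = prodOver-↭ (activity T)
    (filter-drop (undecided? A C) (undecided? (A ∪ ⁅ e ⁆) C)
      (e∈ , e∉) (λ (_ , e∉′) → e∉′ (∈-inserted A))
      (λ ≢e (f∈ , f∉) → f∈ , [ f∉ , ≢e ]′ ∘ ∈-insert⁻) (λ (f∈ , f∉) → f∈ , f∉ ∘ ∈-insert)
      (allFin⁺ #E) (∈-allFin e))

  weight-decided : ∀ A T → weight A A T ≈ 1#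
  weight-decided A T = reflexive (cong (λ es → prodOver es (activity T))
    (List.filter-none (undecided? A A)
      (All.universal (λ e (e∈ , e∉) → e∉ e∈) (allFin #E))))

  weight-undecided : ∀ T → weight ∅ ⊤ T ≈ x ^ 𝓘 𝒢 T * y ^ 𝓔 𝒢 T
  weight-undecided T = begin
    weight ∅ ⊤ T
      ≡⟨ cong (λ es → prodOver es (activity T))
           (List.filter-all (undecided? ∅ ⊤) (All.universal (λ _ → ∈⊤ , ∉⊥) (allFin #E))) ⟩
    prodOver (allFin #E) (activity T)
      ≈⟨ ≈-sym (prodOver-* (allFin #E) _ _) ⟩
    prodOver (allFin #E) (λ e → x when internallyActive? 𝒢 T e) *
    prodOver (allFin #E) (λ e → y when externallyActive? 𝒢 T e)
      ≈⟨ ≈-sym (*-cong (^-length-filter (internallyActive? 𝒢 T) x (allFin #E))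
                     (^-length-filter (externallyActive? 𝒢 T) y (allFin #E))) ⟩
    x ^ 𝓘 𝒢 T * y ^ 𝓔 𝒢 T ∎

  internal-activity : ∀ {T e} → e ∈ T → activity T e ≈ (x when internallyActive? 𝒢 T e)
  internal-activity {T} {e} e∈ = ≈-trans
    (*-congˡ (when-no y (externallyActive? 𝒢 T e) λ (e∉ , _) → e∉ e∈)) (*-identityʳ _)

  external-activity : ∀ {T e} → e ∉ T → activity T e ≈ (y when externallyActive? 𝒢 T e)
  external-activity {T} {e} e∉ = ≈-trans
    (*-congʳ (when-no x (internallyActive? 𝒢 T e) λ (e∈ , _) → e∉ e∈)) (*-identityˡ _)

  [z-1]*a+a≈z*a : ∀ z a → (z -ᴿ 1#) * a + a ≈ z * a
  [z-1]*a+a≈z*a z a = begin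
    (z -ᴿ 1#) * a + a         ≈⟨ +-congˡ (≈-sym (*-identityˡ a)) ⟩
    (z -ᴿ 1#) * a + 1# * a    ≈⟨ ≈-sym (distribʳ a _ _) ⟩
    (z -ᴿ 1# + 1#) * a        ≈⟨ *-congʳ (+-assoc _ _ _) ⟩
    (z + (- 1# + 1#)) * a    ≈⟨ *-congʳ (+-congˡ (-‿inverseˡ 1#)) ⟩
    (z + 0#) * a             ≈⟨ *-congʳ (+-identityʳ z) ⟩
    z * a                    ∎

  subsetSum treeSum : Subset #E → Subset #E → Carrier
  subsetSum A C = intervalSum A C term
  treeSum A C   = intervalSum A C (treeTerm A C)

  -- The deletion–contraction step for an edge e of the minor in which the
  -- edges of A are contracted and those outside C are deleted.
  module Step {A C : Subset #E} {e : E} (e∉A : e ∉ A) (e∈C : e ∈ C)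
    (active-loop : ∀ {T} → IsSpanningTree T → A ⊆ T → T ⊆ C → e ∉ T →
      (Spanned A e → ExternallyActive 𝒢 T e) × (ExternallyActive 𝒢 T e → Spanned A e))
    (active-isthmus : ∀ {T} → IsSpanningTree T → A ⊆ T → T ⊆ C → e ∈ T →
      (¬ Spanned (C - e) e → InternallyActive 𝒢 T e) ×
      (InternallyActive 𝒢 T e → ¬ Spanned (C - e) e)) where

    -- The activity of `e` is the same in all trees of the interval that avoid it, being determined
    -- by `A`, so it can be taken out of the sum. `contractedSum` is the dual, with the activity
    -- determined by `C`.
    deletedSum : ∀ k →
      (∀ {T} → IsSpanningTree T → A ⊆ T → T ⊆ C → e ∉ T →
        (y when externallyActive? 𝒢 T e) ≈ k) →
      intervalSum A (C - e) (treeTerm A C) ≈ k * treeSum A (C - e)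
    deletedSum k eq = intervalSum-scale k A (C - e) λ S A⊆ ⊆C →
      on-scale (isSpanningTree? G S) λ t →
      let e∉S = ∉-deleted C e ∘ ⊆C in
      ≈-trans (weight-delete S e∉A e∈C)
            (*-congʳ (≈-trans (external-activity e∉S) (eq t A⊆ (∈-delete⁻ ∘ ⊆C) e∉S)))

    contractedSum : ∀ k →
      (∀ {T} → IsSpanningTree T → A ⊆ T → T ⊆ C → e ∈ T →
        (x when internallyActive? 𝒢 T e) ≈ k) →
      intervalSum (A ∪ ⁅ e ⁆) C (treeTerm A C) ≈ k * treeSum (A ∪ ⁅ e ⁆) C
    contractedSum k eq = intervalSum-scale k (A ∪ ⁅ e ⁆) C λ S A⊆ ⊆C →
      on-scale (isSpanningTree? G S) λ t →
      let e∈S = A⊆ (∈-inserted A) in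
      ≈-trans (weight-insert S e∉A e∈C)
            (*-congʳ (≈-trans (internal-activity e∈S) (eq t (A⊆ ∘ ∈-insert) ⊆C e∈S)))

    -- Sets with `e` contribute `y - 1` times what sets without it do, in total `y`; on the other
    -- side no tree contains `e`, which is active in all of them.
    loop : Spanned A e → subsetSum A (C - e) ≈ treeSum A (C - e) →
           subsetSum A C ≈ treeSum A C
    loop s ih = begin
      subsetSum A C
        ≈⟨ intervalSum-split A C term e∉A e∈C ⟩
      subsetSum A (C - e) + subsetSum (A ∪ ⁅ e ⁆) C
        ≈⟨ +-congˡ (≈-trans (intervalSum-insert A C term e∉A e∈C)
             (intervalSum-scale (y -ᴿ 1#) A (C - e) λ S A⊆ ⊆C →
               term-insert-spanned (∉-deleted C e ∘ ⊆C) (Linked-mono A⊆ s))) ⟩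
      subsetSum A (C - e) + (y -ᴿ 1#) * subsetSum A (C - e)
        ≈⟨ ≈-trans (+-comm _ _) ([z-1]*a+a≈z*a y _) ⟩
      y * subsetSum A (C - e)
        ≈⟨ *-congˡ ih ⟩
      y * treeSum A (C - e)
        ≈⟨ ≈-sym (deletedSum y λ t A⊆ ⊆C e∉ →
             when-yes y (externallyActive? 𝒢 _ e) (proj₁ (active-loop t A⊆ ⊆C e∉) s)) ⟩
      intervalSum A (C - e) (treeTerm A C)
        ≈⟨ ≈-sym (≈-trans (+-congˡ (intervalSum-zero (A ∪ ⁅ e ⁆) C λ S A⊆ _ →
             on-no (isSpanningTree? G S) λ t → tree⇒forest t (A⊆ (∈-inserted A))
               (Linked-mono (⊆-delete (A⊆ ∘ ∈-insert) e∉A) s))) (+-identityʳ _)) ⟩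
      intervalSum A (C - e) (treeTerm A C) + intervalSum (A ∪ ⁅ e ⁆) C (treeTerm A C)
        ≈⟨ ≈-sym (intervalSum-split A C _ e∉A e∈C) ⟩
      treeSum A C ∎

    -- Dual to `loop`: sets without `e` contribute `x - 1` times what sets with it do, and no tree
    -- avoids `e`.
    isthmus : ¬ Spanned (C - e) e → subsetSum (A ∪ ⁅ e ⁆) C ≈ treeSum (A ∪ ⁅ e ⁆) C →
              subsetSum A C ≈ treeSum A C
    isthmus ¬s ih = begin
      subsetSum A C
        ≈⟨ intervalSum-split A C term e∉A e∈C ⟩
      subsetSum A (C - e) + subsetSum (A ∪ ⁅ e ⁆) C
        ≈⟨ +-congʳ (≈-trans
             (intervalSum-scale (x -ᴿ 1#) A (C - e) λ S A⊆ ⊆C →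
               term-insert-unspanned (∉-deleted C e ∘ ⊆C) (¬s ∘ Linked-mono ⊆C))
             (*-congˡ (≈-sym (intervalSum-insert A C term e∉A e∈C)))) ⟩
      (x -ᴿ 1#) * subsetSum (A ∪ ⁅ e ⁆) C + subsetSum (A ∪ ⁅ e ⁆) C
        ≈⟨ [z-1]*a+a≈z*a x _ ⟩
      x * subsetSum (A ∪ ⁅ e ⁆) C
        ≈⟨ *-congˡ ih ⟩
      x * treeSum (A ∪ ⁅ e ⁆) C
        ≈⟨ ≈-sym (contractedSum x λ t A⊆ ⊆C e∈ →
             when-yes x (internallyActive? 𝒢 _ e) (proj₁ (active-isthmus t A⊆ ⊆C e∈) ¬s)) ⟩
      intervalSum (A ∪ ⁅ e ⁆) C (treeTerm A C)
        ≈⟨ ≈-sym (≈-trans (+-congʳ (intervalSum-zero A (C - e) λ S _ ⊆C →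
             on-no (isSpanningTree? G S) λ t → ¬s (Linked-mono ⊆C (proj₁ t _ _))))
             (+-identityˡ _)) ⟩
      intervalSum A (C - e) (treeTerm A C) + intervalSum (A ∪ ⁅ e ⁆) C (treeTerm A C)
        ≈⟨ ≈-sym (intervalSum-split A C _ e∉A e∈C) ⟩
      treeSum A C ∎

    ordinary : ¬ Spanned A e → Spanned (C - e) e →
      subsetSum A (C - e) ≈ treeSum A (C - e) →
      subsetSum (A ∪ ⁅ e ⁆) C ≈ treeSum (A ∪ ⁅ e ⁆) C →
      subsetSum A C ≈ treeSum A C
    ordinary ¬l s ih₁ ih₂ = begin
      subsetSum A C
        ≈⟨ intervalSum-split A C term e∉A e∈C ⟩
      subsetSum A (C - e) + subsetSum (A ∪ ⁅ e ⁆) C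
        ≈⟨ +-cong (≈-trans ih₁ (≈-sym (*-identityˡ _)))
                  (≈-trans ih₂ (≈-sym (*-identityˡ _))) ⟩
      1# * treeSum A (C - e) + 1# * treeSum (A ∪ ⁅ e ⁆) C
        ≈⟨ ≈-sym (+-cong
             (deletedSum 1# λ t A⊆ ⊆C e∉ → when-no y (externallyActive? 𝒢 _ e)
               (¬l ∘ proj₂ (active-loop t A⊆ ⊆C e∉)))
             (contractedSum 1# λ t A⊆ ⊆C e∈ → when-no x (internallyActive? 𝒢 _ e)
               λ a → proj₂ (active-isthmus t A⊆ ⊆C e∈) a s)) ⟩
      intervalSum A (C - e) (treeTerm A C) + intervalSum (A ∪ ⁅ e ⁆) C (treeTerm A C)
        ≈⟨ ≈-sym (intervalSum-split A C _ e∉A e∈C) ⟩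
      treeSum A C ∎

  -- The tour has been read backwards down to its m-th half-edge h: for every tree
  -- T between A and C this half-edge is the same, and the edges met so far are
  -- those contracted (in A) or deleted (not in C).
  record State (A C : Subset #E) (m : ℕ) (h : H) : Set where
    field
      forest    : Forest A
      connected : IsConnected C
      A⊆C       : A ⊆ C
      at        : ∀ {T} (t : IsSpanningTree T) → A ⊆ T → T ⊆ C →
                  TourLemmas.tour 𝒢 t m ≡ h
      decided⇒  : ∀ {T} (t : IsSpanningTree T) → A ⊆ T → T ⊆ C →
                  ∀ {f} → f ∈ A ⊎ f ∉ C → m ≤ TourLemmas.maxRank 𝒢 t f
      decided⇐  : ∀ {T} (t : IsSpanningTree T) → A ⊆ T → T ⊆ C →
                  ∀ {f} → m ≤ TourLemmas.maxRank 𝒢 t f → f ∈ A ⊎ f ∉ C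

  -- The half-edge before h is α g or g, depending on the status of the edge of g.
  module Backwards {A C : Subset #E} {m : ℕ} {h : H}
                   (m<#H : m < #H) (state : State A C (suc m) h) where
    open State state

    g : H
    g = σ ⟨$⟩ˡ h

    e : E
    e = edgeOf g

    module _ {T} (t : IsSpanningTree T) (A⊆T : A ⊆ T) (T⊆C : T ⊆ C) where
      open TourLemmas 𝒢 t

      previous-internal : e ∈ T → tour m ≡ α g
      previous-internal e∈ = motion-injective T (trans (at t A⊆T T⊆C)
        (sym (trans (motion-internal T (α-∈ T refl e∈))
          (trans (cong σ′ (α-involutive g)) (inverseʳ σ)))))

      previous-external : e ∉ T → tour m ≡ g
      previous-external e∉ = motion-injective T (trans (at t A⊆T T⊆C)
        (sym (trans (motion-external T e∉) (inverseʳ σ))))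

      edgeOf-previous : edgeOf (tour m) ≡ e
      edgeOf-previous with e ∈? T
      ... | yes e∈ = trans (cong edgeOf (previous-internal e∈)) (edgeOf-α g)
      ... | no  e∉ = cong edgeOf (previous-external e∉)

      m≤maxRank : m ≤ maxRank e
      m≤maxRank = subst₂ _≤_ (rank-tour m<#H)
        (trans (sym (maxRank-half (tour m))) (cong maxRank edgeOf-previous))
        (ℕ.m≤m⊔n (r (tour m)) _)

      -- The only edge newly met at position `m` is the one whose half-edge stands there, and that
      -- is `e`.
      next-decided⇐ : ∀ {f} → m ≤ maxRank f → (f ∈ A ⊎ f ∉ C) ⊎ f ≡ e
      next-decided⇐ {f} m≤ with ℕ.m≤n⇒m<n∨m≡n m≤
      ... | inj₁ m<  = inj₁ (decided⇐ t A⊆T T⊆C m<)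
      ... | inj₂ m≡ = inj₂ (sym (trans (sym edgeOf-previous) edgeOf≡f))
        where
        at-m : ∀ k → r k ≡ m → tour m ≡ k
        at-m k eq = trans (cong tour (sym eq)) (tour-rank k)
        edgeOf≡f : edgeOf (tour m) ≡ f
        edgeOf≡f with ℕ.⊔-sel (r (halfOf f)) (r (α (halfOf f)))
        ... | inj₁ eq = trans (cong edgeOf (at-m _ (sym (trans m≡ eq))))
                                (edgeOf-halfOf f)
        ... | inj₂ eq = trans (cong edgeOf (at-m _ (sym (trans m≡ eq))))
                                (trans (edgeOf-α (halfOf f)) (edgeOf-halfOf f))

      next-decided⇒ : ∀ {f} → (f ∈ A ⊎ f ∉ C) ⊎ f ≡ e → m ≤ maxRank f
      next-decided⇒ (inj₁ d)      = ℕ.<⇒≤ (decided⇒ t A⊆T T⊆C d)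
      next-decided⇒ (inj₂ refl) = m≤maxRank

    skip-contracted : e ∈ A → State A C m (α g)
    skip-contracted e∈ = record
      { forest = forest ; connected = connected ; A⊆C = A⊆C
      ; at = λ t A⊆ ⊆C → previous-internal t A⊆ ⊆C (A⊆ e∈)
      ; decided⇒ = λ t A⊆ ⊆C → next-decided⇒ t A⊆ ⊆C ∘ inj₁
      ; decided⇐ = λ t A⊆ ⊆C → [ id , (λ { refl → inj₁ e∈ }) ]′ ∘ next-decided⇐ t A⊆ ⊆C
      }

    skip-deleted : e ∉ C → State A C m g
    skip-deleted e∉ = record
      { forest = forest ; connected = connected ; A⊆C = A⊆C
      ; at = λ t A⊆ ⊆C → previous-external t A⊆ ⊆C (e∉ ∘ ⊆C)
      ; decided⇒ = λ t A⊆ ⊆C → next-decided⇒ t A⊆ ⊆C ∘ inj₁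
      ; decided⇐ = λ t A⊆ ⊆C → [ id , (λ { refl → inj₂ e∉ }) ]′ ∘ next-decided⇐ t A⊆ ⊆C
      }

    module _ (e∉A : e ∉ A) (e∈C : e ∈ C) where

      -- Contracting only non-loops keeps `A` a forest; `delete` keeps `C` connected in the same
      -- way, so a spanning tree between them always remains.
      contract : ¬ Spanned A e → State (A ∪ ⁅ e ⁆) C m (α g)
      contract ¬s = record
        { forest = Forest-insert forest ¬s ; connected = connected
        ; A⊆C = insert-⊆ A⊆C e∈C
        ; at = λ t A⊆ ⊆C → previous-internal t (A⊆ ∘ ∈-insert) ⊆C (A⊆ (∈-inserted A))
        ; decided⇒ = λ t A⊆ ⊆C → next-decided⇒ t (A⊆ ∘ ∈-insert) ⊆C ∘
            [ Sum.map₁ inj₁ ∘ ∈-insert⁻ , inj₁ ∘ inj₂ ]′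
        ; decided⇐ = λ t A⊆ ⊆C →
            [ Sum.map₁ ∈-insert , (λ { refl → inj₁ (∈-inserted A) }) ]′ ∘
            next-decided⇐ t (A⊆ ∘ ∈-insert) ⊆C
        }

      delete : Spanned (C - e) e → State A (C - e) m g
      delete s = record
        { forest = forest ; connected = IsConnected-delete connected s
        ; A⊆C = ⊆-delete A⊆C e∉A
        ; at = λ t A⊆ ⊆C → previous-external t A⊆ (∈-delete⁻ ∘ ⊆C) (∉-deleted C e ∘ ⊆C)
        ; decided⇒ = λ t A⊆ ⊆C → next-decided⇒ t A⊆ (∈-delete⁻ ∘ ⊆C) ∘
            [ inj₁ ∘ inj₁ , deleted ]′
        ; decided⇐ = λ t A⊆ ⊆C →
            [ Sum.map₂ (_∘ ∈-delete⁻) , (λ { refl → inj₂ (∉-deleted C e) }) ]′ ∘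
            next-decided⇐ t A⊆ (∈-delete⁻ ∘ ⊆C)
        }
        where
        deleted : ∀ {f} → f ∉ C - e → (f ∈ A ⊎ f ∉ C) ⊎ f ≡ e
        deleted {f} f∉ with f ≟ e
        ... | yes f≡e = inj₂ f≡e
        ... | no  f≢e = inj₁ (inj₂ λ f∈ → f∉ (∈-delete⁺ f∈ f≢e))

      module _ {T} (t : IsSpanningTree T) (A⊆T : A ⊆ T) (T⊆C : T ⊆ C) where
        open TourLemmas 𝒢 t

        -- A half of `e` stands at position `m`, and none stands later because `e` is undecided.
        maxRank≡m : maxRank e ≡ m
        maxRank≡m = ℕ.≤-antisym
          (ℕ.≮⇒≥ ([ e∉A , (λ e∉C → e∉C e∈C) ]′ ∘ decided⇐ t A⊆T T⊆C)) (m≤maxRank t A⊆T T⊆C)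

        visited⇒ : ∀ {f} → f ∈ A ⊎ f ∉ C → maxRank e < maxRank f
        visited⇒ {f} d = subst (_< maxRank f) (sym maxRank≡m) (decided⇒ t A⊆T T⊆C d)

        visited⇐ : ∀ {f} → maxRank e < maxRank f → f ∈ A ⊎ f ∉ C
        visited⇐ {f} lt = decided⇐ t A⊆T T⊆C (subst (_< maxRank f) maxRank≡m lt)

        visited⇐A : ∀ {f} → f ∈ T → maxRank e < maxRank f → f ∈ A
        visited⇐A f∈ = [ id , (λ f∉ → contradiction (T⊆C f∈) f∉) ]′ ∘ visited⇐

        visited⇐C : ∀ {f} → f ∉ T → maxRank e < maxRank f → f ∉ C
        visited⇐C f∉ = [ (λ f∈ → contradiction (A⊆T f∈) f∉) , id ]′ ∘ visited⇐

        active-loop : e ∉ T → (Spanned A e → ExternallyActive 𝒢 T e) ×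
                              (ExternallyActive 𝒢 T e → Spanned A e)
        active-loop e∉ =
          spanned⇒externallyActive A⊆T e∉ (visited⇒ ∘ inj₁) visited⇐A ,
          externallyActive⇒spanned A⊆T e∉ (visited⇒ ∘ inj₁) visited⇐A

        active-isthmus : e ∈ T → (¬ Spanned (C - e) e → InternallyActive 𝒢 T e) ×
                                 (InternallyActive 𝒢 T e → ¬ Spanned (C - e) e)
        active-isthmus e∈ =
          unspanned⇒internallyActive T⊆C e∈ (visited⇒ ∘ inj₂) visited⇐C ,
          internallyActive⇒unspanned T⊆C e∈ (visited⇒ ∘ inj₂) visited⇐C

  subsetSum≈treeSum : IsConnected ⊤ → ∀ m {A C h} → m ≤ #H → State A C m h →
                      subsetSum A C ≈ treeSum A C
  -- At position 0 every edge is decided, so `A` and `C` coincide. As `decided⇐` speaks about trees,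
  -- one has to be supplied; it then equals `A`, and both sums reduce to 1.
  subsetSum≈treeSum conn zero {A} {C} _ state
    with tree-between (State.forest state) (State.connected state) (State.A⊆C state)
  ... | T , t , A⊆T , T⊆C
    with ⊆-antisym (State.A⊆C state) C⊆A | ⊆-antisym A⊆T (C⊆A ∘ T⊆C)
    where
    C⊆A : C ⊆ A
    C⊆A f∈ = [ id , contradiction f∈ ]′ (State.decided⇐ state t A⊆T T⊆C ℕ.z≤n)
  ... | refl | refl = begin
    subsetSum A A   ≈⟨ intervalSum-singleton A term ⟩
    term A          ≈⟨ term-tree conn t ⟩
    1#              ≈⟨ ≈-sym (≈-trans (on-yes (isSpanningTree? G A) t)
                                        (weight-decided A A)) ⟩
    treeTerm A A A  ≈⟨ ≈-sym (intervalSum-singleton A _) ⟩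
    treeSum A A     ∎
  subsetSum≈treeSum conn (suc m) {A} {C} m<#H state with e ∈? A | e ∈? C
    where open Backwards m<#H state using (e)
  ... | yes e∈A | _       = subsetSum≈treeSum conn m (ℕ.<⇒≤ m<#H)
    (Backwards.skip-contracted m<#H state e∈A)
  ... | no  _   | no  e∉C = subsetSum≈treeSum conn m (ℕ.<⇒≤ m<#H)
    (Backwards.skip-deleted m<#H state e∉C)
  -- Three cases suffice: as `A ⊆ C - e`, a loop is never an isthmus. A loop is only deleted and an
  -- isthmus only contracted, since the other branch would contain no tree.
  ... | no  e∉A | yes e∈C with spanned? A e | spanned? (C - e) e
    where open Backwards m<#H state using (e)
  ...   | yes s | _ = Step.loop e∉A e∈C
    (Backwards.active-loop m<#H state e∉A e∈C)
    (Backwards.active-isthmus m<#H state e∉A e∈C) s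
    (subsetSum≈treeSum conn m (ℕ.<⇒≤ m<#H) (Backwards.delete m<#H state e∉A e∈C
      (Linked-mono (⊆-delete (State.A⊆C state) e∉A) s)))
  ...   | no ¬l | no ¬s = Step.isthmus e∉A e∈C
    (Backwards.active-loop m<#H state e∉A e∈C)
    (Backwards.active-isthmus m<#H state e∉A e∈C) ¬s
    (subsetSum≈treeSum conn m (ℕ.<⇒≤ m<#H) (Backwards.contract m<#H state e∉A e∈C ¬l))
  ...   | no ¬l | yes s = Step.ordinary e∉A e∈C
    (Backwards.active-loop m<#H state e∉A e∈C)
    (Backwards.active-isthmus m<#H state e∉A e∈C) ¬l s
    (subsetSum≈treeSum conn m (ℕ.<⇒≤ m<#H) (Backwards.delete m<#H state e∉A e∈C s))
    (subsetSum≈treeSum conn m (ℕ.<⇒≤ m<#H) (Backwards.contract m<#H state e∉A e∈C ¬l))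

  initial : IsConnected ⊤ → State ∅ ⊤ #H root
  initial conn = record
    { forest = λ e∈ → contradiction e∈ ∉⊥ ; connected = conn ; A⊆C = ⊆-min ⊤
    -- Reading starts at position `#H`, one past the last rank: every tour is then back at the root,
    -- and no edge has been met.
    ; at = λ t _ _ → TourLemmas.tour-#H 𝒢 t
    ; decided⇒ = λ _ _ _ → [ (λ e∈ → contradiction e∈ ∉⊥) , (λ e∉ → contradiction ∈⊤ e∉) ]′
    ; decided⇐ = λ t _ _ {f} #H≤ → contradiction
        (ℕ.⊔-lub (TourLemmas.rank<#H 𝒢 t (halfOf f))
                 (TourLemmas.rank<#H 𝒢 t (α (halfOf f))))
        (ℕ.≤⇒≯ #H≤)
    }

theorem7 : ∀ {c ℓ} (R : CommutativeRing c ℓ) →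
    let open CommutativeRing R in
    let open Algebra.Properties.Semiring.Exp semiring using (_^_) in
    (G : Graph) → Graph.IsConnected G ⊤ → 1 ≤ Graph.#E G →
    (𝒢 : RootedEmbedding G) (x y : Carrier) →
    tutte R G x y ≈ sumOver R (spanningTrees G) (λ T → x ^ 𝓘 𝒢 T * y ^ 𝓔 𝒢 T)
theorem7 R G conn _ 𝒢 x y = begin
  tutte R G x y
    ≈⟨ sumOver-subsets #E _ ⟩
  subsetSum R 𝒢 x y ∅ ⊤
    ≈⟨ subsetSum≈treeSum R 𝒢 x y conn #H ℕ.≤-refl (initial R 𝒢 x y conn) ⟩
  treeSum R 𝒢 x y ∅ ⊤
    ≈⟨ intervalSum-cong ∅ ⊤ (λ T _ _ →
         on-cong (isSpanningTree? G T) (weight-undecided R 𝒢 x y T)) ⟩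
  intervalSum ∅ ⊤ (λ T → (x ^ 𝓘 𝒢 T * y ^ 𝓔 𝒢 T) on isSpanningTree? G T)
    ≈⟨ sumOver-subsets #E _ ⟨
  sumOver R (subsets #E) (λ T → (x ^ 𝓘 𝒢 T * y ^ 𝓔 𝒢 T) on isSpanningTree? G T)
    ≈⟨ sumOver-filter (isSpanningTree? G) (subsets #E) _ ⟨
  sumOver R (spanningTrees G) (λ T → x ^ 𝓘 𝒢 T * y ^ 𝓔 𝒢 T) ∎
  where
  open CommutativeRing R hiding (zero; _-_)
    renaming (refl to ≈-refl; sym to ≈-sym; trans to ≈-trans)
  open Algebra.Properties.Semiring.Exp semiring using (_^_)
  open import Relation.Binary.Reasoning.Setoid setoid
  open RingSums R
  open Graph G
  open RootedEmbedding 𝒢
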